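{- Let $f \in \tilde{\mathscr{A}}$. If there exists some $n \in \mathbb{Z}$ with $|n| > 1$ such that the entrywise product $\mathrm{TS}_n f$ is a residual square root of $n$, then the image of $f$ in $\mathscr{A}$ is naively transcendental.
   Context: $\mathbb{P}$ denotes the set of prime numbers; $\mathbb{F}_p = \mathbb{Z}/p\mathbb{Z}$; $\mathbb{Z}_{(p)} \subset \mathbb{Q}$ is the localisation of $\mathbb{Z}$ at the prime ideal $p\mathbb{Z}$. For $q_0, q_1 \in \mathbb{Q}$ and $p \in \mathbb{P}$, $q_0 \equiv q_1 \pmod{p}$ means $q_0 - q_1 \in p\mathbb{Z}_{(p)}$ and $q_1 \in \mathbb{Z}_{(p)}$. For $q \in \mathbb{Z}_{(p)}$, $q \bmod p \in \mathbb{F}_p$ is its residue class, and for $q \in \mathbb{Q} \setminus \mathbb{Z}_{(p)}$ one sets $q \bmod p = 0$. $\mathscr{A} = \prod_{p \in \mathbb{P}} \mathbb{F}_p \big/ \bigoplus_{p \in \mathbb{P}} \mathbb{F}_p$, a commutative $\mathbb{Q}$-algebra. $\tilde{\mathscr{A}}$ is the set of $a \in \mathbb{Q}^{\mathbb{P}}$ such that $a(p) \notin \mathbb{Z}_{(p)}$ for only finitely many $p \in \mathbb{P}$. The image of $a \in \tilde{\mathscr{A}}$ in $\mathscr{A}$ is the class of $(a(p) \bmod p)_{p \in \mathbb{P}}$. An element $\alpha \in \mathscr{A}$ is naively algebraic if there is a nonzero $g \in \mathbb{Q}[x]$ with $g(\alpha) = 0$, and naively transcendental otherwise. For a positive integer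 $m$, $u_2(m)$ denotes the greatest odd divisor of $m$. For $n \in \mathbb{Z}$, Tonelli--Shanks power of $n$ is the map $\mathrm{TS}_n \colon \mathbb{P} \to \mathbb{Z}$, $\mathrm{TS}_n(p) = n^{\frac{u_2(p-1)+1}{2}}$. For $n \in \mathbb{Z}$, an element $r \in \tilde{\mathscr{A}}$ is a residual square root of $n$ if there exists some $q \in \mathbb{Q}^{\times}$ such that for every $p \in \mathbb{P}$: if $\left(\frac{n}{p}\right) = -1$ then $r(p) \equiv q \pmod{p}$, and if $\left(\frac{n}{p}\right) \neq -1$ then $r(p)^2 \equiv n \pmod{p}$. Here $\left(\frac{n}{p}\right)$ is the Legendre symbol, with $\left(\frac{n}{p}\right) = -1$ meaning that $n$ is not congruent to a square modulo $p$ (so this never occurs for $p = 2$). -}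

module Defs where

open import Algebra.Bundles using (CommutativeRing)
open import Algebra.Morphism.Structures using (module RingMorphisms)
open import Data.Empty using (⊥-elim)
open import Data.Integer.Base as ℤ using (ℤ; +_)
import Data.Integer.Divisibility.Signed as ℤ
import Data.Integer.Properties as ℤ
open import Data.Integer.Solver using (module +-*-Solver)
open import Data.List.Base using (List; []; _∷_; _++_; filter; upTo)
open import Data.List.Extrema.Nat using (max)
open import Data.List.Membership.Propositional using (_∈_)
open import Data.List.Membership.Propositional.Properties using (∈-++⁺ˡ; ∈-++⁺ʳ)
open import Data.List.Relation.Unary.Any using (Any; here; there)
open import Data.Nat.Base as ℕ using (ℕ; zero; suc; NonZero)
open import Data.Nat.Coprimality using (Coprime; coprime-Bézout)
import Data.Nat.DivMod as ℕ
import Data.Nat.Divisibility as ℕ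
open import Data.Nat.GCD using (module Bézout)
open import Data.Nat.Primality using (Prime; prime?; prime⇒irreducible; euclidsLemma; prime⇒nonTrivial)
import Data.Nat.Properties as ℕ
open import Data.Product.Base using (Σ; ∃; ∃-syntax; _×_; _,_; proj₁; proj₂)
open import Data.Rational.Base as ℚ using (ℚ; 0ℚ; _/_; ↥_; ↧_; ↧ₙ_)
import Data.Rational.Properties as ℚ
import Data.Rational.Unnormalised.Base as ℚᵘ
open import Data.Sum.Base using (_⊎_; inj₁; inj₂; [_,_]′)
open import Level using (0ℓ)
open import Relation.Binary.PropositionalEquality
  using (_≡_; _≢_; refl; sym; trans; cong; subst; module ≡-Reasoning)
open import Relation.Binary.Structures using (IsEquivalence)
open import Relation.Nullary using (¬_; Dec; yes; no; ¬?; _×-dec_)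
open import Relation.Nullary.Decidable using (decidable-stable; map′)

-- Proofs of `Prime p` are definitionally unique, so an element of ℙ is
-- determined by its first component.
ℙ : Set
ℙ = Σ ℕ Prime

FinitelyMany : (ℙ → Set) → Set
FinitelyMany P = ∃[ ps ] (∀ p → P p → p ∈ ps)

-- 𝔽ₚ is represented by ℤ with congruence modulo p as its equality.
infix 4 _≡ℤ_[mod_]

record _≡ℤ_[mod_] (a b : ℤ) (p : ℙ) : Set where
  constructor congruent
  field
    p∣a-b : + proj₁ p ℤ.∣ a ℤ.- b

infix 4 _∈ℤ₍_₎ _∈pℤ₍_₎ _≡ℚ_[mod_]

record _∈ℤ₍_₎ (q : ℚ) (p : ℙ) : Set where
  constructor fraction
  field
    num           : ℤ
    den           : ℕ
    .{{den-nonZero}} : NonZero den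
    p∤den         : ¬ (proj₁ p ℕ.∣ den)
    q≡num/den     : q ≡ num / den

_∈pℤ₍_₎ : ℚ → ℙ → Set
q ∈pℤ₍ p ₎ = ∃[ r ] (r ∈ℤ₍ p ₎ × q ≡ (+ proj₁ p / 1) ℚ.* r)

_≡ℚ_[mod_] : ℚ → ℚ → ℙ → Set
q₀ ≡ℚ q₁ [mod p ] = (q₀ ℚ.- q₁ ∈pℤ₍ p ₎) × (q₁ ∈ℤ₍ p ₎)

module _ (p : ℙ) where

  private
    P : ℤ
    P = + proj₁ p

    lift : ∀ {a b} k → a ℤ.- b ≡ k ℤ.* P → a ≡ℤ b [mod p ]
    lift k eq = congruent (ℤ.divides k eq)

  open +-*-Solver

  ≡ℤ-reflexive : ∀ {a b} → a ≡ b → a ≡ℤ b [mod p ]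
  ≡ℤ-reflexive {a} refl = congruent (ℤ.divides (+ 0)
    (trans (ℤ.+-inverseʳ a) (sym (ℤ.*-zeroˡ P))))

  ≡ℤ-sym : ∀ {a b} → a ≡ℤ b [mod p ] → b ≡ℤ a [mod p ]
  ≡ℤ-sym {a} {b} (congruent d) = congruent (subst (P ℤ.∣_)
    (solve 2 (λ a b → :- (a :- b) := b :- a) refl a b) (ℤ.∣m⇒∣-m d))

  ≡ℤ-trans : ∀ {a b c} → a ≡ℤ b [mod p ] → b ≡ℤ c [mod p ] → a ≡ℤ c [mod p ]
  ≡ℤ-trans {a} {b} {c} (congruent d) (congruent e) = congruent (subst (P ℤ.∣_)
    (solve 3 (λ a b c → (a :- b) :+ (b :- c) := a :- c) refl a b c) (ℤ.∣m∣n⇒∣m+n d e))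

  ≡ℤ-+ : ∀ {a a′ b b′} → a ≡ℤ a′ [mod p ] → b ≡ℤ b′ [mod p ] →
         a ℤ.+ b ≡ℤ a′ ℤ.+ b′ [mod p ]
  ≡ℤ-+ {a} {a′} {b} {b′} (congruent d) (congruent e) = congruent (subst (P ℤ.∣_)
    (solve 4 (λ a a′ b b′ → (a :- a′) :+ (b :- b′) := (a :+ b) :- (a′ :+ b′)) refl a a′ b b′)
    (ℤ.∣m∣n⇒∣m+n d e))

  ≡ℤ-* : ∀ {a a′ b b′} → a ≡ℤ a′ [mod p ] → b ≡ℤ b′ [mod p ] →
         a ℤ.* b ≡ℤ a′ ℤ.* b′ [mod p ]
  ≡ℤ-* {a} {a′} {b} {b′} (congruent d) (congruent e) = congruent (subst (P ℤ.∣_)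
    (solve 4 (λ a a′ b b′ → (a :- a′) :* b :+ a′ :* (b :- b′) := (a :* b) :- (a′ :* b′))
      refl a a′ b b′)
    (ℤ.∣m∣n⇒∣m+n (ℤ.∣m⇒∣m*n b d) (ℤ.∣n⇒∣m*n a′ e)))

  ≡ℤ-neg : ∀ {a a′} → a ≡ℤ a′ [mod p ] → ℤ.- a ≡ℤ ℤ.- a′ [mod p ]
  ≡ℤ-neg {a} {a′} (congruent d) = congruent (subst (P ℤ.∣_)
    (solve 2 (λ a b → :- (a :- b) := (:- a) :- (:- b)) refl a a′) (ℤ.∣m⇒∣-m d))

  _≡ℤ?_ : ∀ a b → Dec (a ≡ℤ b [mod p ])
  a ≡ℤ? b = map′ congruent _≡ℤ_[mod_].p∣a-b (P ℤ.∣? (a ℤ.- b))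

  inverse : ∀ b → ¬ (proj₁ p ℕ.∣ b) → ∃[ x ] (x ℤ.* + b ≡ℤ + 1 [mod p ])
  inverse b p∤b = go (coprime-Bézout coprime)
    where
    coprime : Coprime (proj₁ p) b
    coprime {d} (d∣p , d∣b) =
      [ (λ eq → eq) , (λ { refl → ⊥-elim (p∤b d∣b) }) ]′ (prime⇒irreducible (proj₂ p) d∣p)

    pos : ∀ x y m n → 1 ℕ.+ x ℕ.* m ≡ y ℕ.* n →
          + 1 ℤ.+ + x ℤ.* + m ≡ + y ℤ.* + n
    pos x y m n eq = begin
      + 1 ℤ.+ + x ℤ.* + m    ≡⟨ cong (ℤ._+_ (+ 1)) (sym (ℤ.pos-* x m)) ⟩
      + (1 ℕ.+ x ℕ.* m)      ≡⟨ cong +_ eq ⟩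
      + (y ℕ.* n)            ≡⟨ ℤ.pos-* y n ⟩
      + y ℤ.* + n            ∎
      where open ≡-Reasoning

    go : Bézout.Identity 1 (proj₁ p) b → ∃[ x ] (x ℤ.* + b ≡ℤ + 1 [mod p ])
    go (Bézout.+- x y eq) = ℤ.- (+ y) , lift (ℤ.- (+ x)) (begin
      ℤ.- (+ y) ℤ.* + b ℤ.- + 1
        ≡⟨ solve 2 (λ y b → (:- y) :* b :- con (+ 1) := :- (con (+ 1) :+ y :* b)) refl (+ y) (+ b) ⟩
      ℤ.- (+ 1 ℤ.+ + y ℤ.* + b)
        ≡⟨ cong ℤ.-_ (pos y x b (proj₁ p) eq) ⟩
      ℤ.- (+ x ℤ.* P)
        ≡⟨ ℤ.neg-distribˡ-* (+ x) P ⟩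
      ℤ.- (+ x) ℤ.* P ∎)
      where open ≡-Reasoning
    go (Bézout.-+ x y eq) = + y , lift (+ x) (begin
      + y ℤ.* + b ℤ.- + 1
        ≡⟨ cong (ℤ._- + 1) (sym (pos x y (proj₁ p) b eq)) ⟩
      + 1 ℤ.+ + x ℤ.* P ℤ.- + 1
        ≡⟨ solve 1 (λ z → con (+ 1) :+ z :- con (+ 1) := z) refl (+ x ℤ.* P) ⟩
      + x ℤ.* P ∎)
      where open ≡-Reasoning

  ≡ℤ-cancel : ∀ {a a′} b → ¬ (proj₁ p ℕ.∣ b) →
              a ℤ.* + b ≡ℤ a′ ℤ.* + b [mod p ] → a ≡ℤ a′ [mod p ]
  ≡ℤ-cancel {a} {a′} b p∤b d with inverse b p∤b
  ... | x , xb≡1 = ≡ℤ-trans (≡ℤ-sym (to a)) (≡ℤ-trans (≡ℤ-* (≡ℤ-reflexive {x} refl) d) (to a′))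
    where
    to : ∀ c → x ℤ.* (c ℤ.* + b) ≡ℤ c [mod p ]
    to c = ≡ℤ-trans
      (≡ℤ-reflexive (solve 3 (λ x c b → x :* (c :* b) := c :* (x :* b)) refl x c (+ b)))
      (≡ℤ-trans (≡ℤ-* (≡ℤ-reflexive {c} refl) xb≡1) (≡ℤ-reflexive (ℤ.*-identityʳ c)))

cross-multiply : ∀ a b c d .{{_ : NonZero b}} .{{_ : NonZero d}} →
                 a / b ≡ c / d → a ℤ.* + d ≡ c ℤ.* + b
cross-multiply a (suc b) c (suc d) eq
  with ℚ.fromℚᵘ-injective {ℚᵘ.mkℚᵘ a b} {ℚᵘ.mkℚᵘ c d} eq
... | ℚᵘ.*≡* e = e

↧∣den : ∀ a b .{{_ : NonZero b}} → ↧ₙ (a / b) ℕ.∣ b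
↧∣den a b = ℤ.∣⇒∣ᵤ {↧ (a / b)} {+ b}
  (subst (↧ (a / b) ℤ.∣_) (ℚ.↧-/ a b) (ℤ.∣m⇒∣m*n _ ℤ.∣-refl))

∈ℤ₍₎⇒p∤↧ : ∀ {q p} → q ∈ℤ₍ p ₎ → ¬ (proj₁ p ℕ.∣ ↧ₙ q)
∈ℤ₍₎⇒p∤↧ (fraction a b p∤b refl) p∣↧ = p∤b (ℕ.∣-trans p∣↧ (↧∣den a b))

p∤↧⇒∈ℤ₍₎ : ∀ {q p} → ¬ (proj₁ p ℕ.∣ ↧ₙ q) → q ∈ℤ₍ p ₎
p∤↧⇒∈ℤ₍₎ {q@record{}} p∤↧ = fraction (↥ q) (↧ₙ q) p∤↧ (sym (ℚ.↥p/↧p≡p q))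

_∈ℤ₍_₎? : ∀ q p → Dec (q ∈ℤ₍ p ₎)
q ∈ℤ₍ p ₎? with proj₁ p ℕ.∣? ↧ₙ q
... | yes p∣↧ = no  λ q∈ → ∈ℤ₍₎⇒p∤↧ {q} {p} q∈ p∣↧
... | no  p∤↧ = yes (p∤↧⇒∈ℤ₍₎ p∤↧)

-- The class of a / b is a · b⁻¹ in 𝔽ₚ, and is set to 0 outside ℤ₍ₚ₎.
infixl 7 _mod_

_mod_ : ℚ → ℙ → ℤ
q mod p with q ∈ℤ₍ p ₎?
... | yes (fraction a b p∤b _) = a ℤ.* proj₁ (inverse p b p∤b)
... | no  _                    = + 0

-- The residue class does not depend on the fraction representing q.
mod-unique : ∀ {q p} a b .{{_ : NonZero b}} → ¬ (proj₁ p ℕ.∣ b) → q ≡ a / b →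
             (q mod p) ℤ.* + b ≡ℤ a [mod p ]
mod-unique {q} {p} a b p∤b q≡a/b with q ∈ℤ₍ p ₎?
... | no q∉ = ⊥-elim (q∉ (fraction a b p∤b q≡a/b))
... | yes (fraction c d p∤d q≡c/d) with inverse p d p∤d
...   | x , xd≡1 = ≡ℤ-trans p (≡ℤ-reflexive p eq)
          (≡ℤ-trans p (≡ℤ-* p (≡ℤ-reflexive p {a} refl) xd≡1) (≡ℤ-reflexive p (ℤ.*-identityʳ a)))
  where
  open ≡-Reasoning
  open +-*-Solver
  eq : c ℤ.* x ℤ.* + b ≡ a ℤ.* (x ℤ.* + d)
  eq = begin
    c ℤ.* x ℤ.* + b   ≡⟨ solve 3 (λ c x b → c :* x :* b := c :* b :* x) refl c x (+ b) ⟩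
    c ℤ.* + b ℤ.* x   ≡⟨ cong (ℤ._* x) (cross-multiply c d a b (trans (sym q≡c/d) q≡a/b)) ⟩
    a ℤ.* + d ℤ.* x   ≡⟨ solve 3 (λ a x d → a :* d :* x := a :* (x :* d)) refl a x (+ d) ⟩
    a ℤ.* (x ℤ.* + d) ∎

private
  module Reduced {q : ℚ} {p : ℙ} (q∈ : q ∈ℤ₍ p ₎) where
    p∤ : ¬ (proj₁ p ℕ.∣ ↧ₙ q)
    p∤ = ∈ℤ₍₎⇒p∤↧ {q} {p} q∈

    num≡ : (q mod p) ℤ.* ↧ q ≡ℤ ↥ q [mod p ]
    num≡ = mod-unique {q} {p} (↥ q) (↧ₙ q) p∤ (sym (ℚ.↥p/↧p≡p q))

  p∤* : ∀ (p : ℙ) m n → ¬ (proj₁ p ℕ.∣ m) → ¬ (proj₁ p ℕ.∣ n) → ¬ (proj₁ p ℕ.∣ m ℕ.* n)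
  p∤* (p , pr) m n p∤m p∤n p∣mn = [ p∤m , p∤n ]′ (euclidsLemma m n pr p∣mn)

+-mod : ∀ {q r p} → q ∈ℤ₍ p ₎ → r ∈ℤ₍ p ₎ →
        (q ℚ.+ r) mod p ≡ℤ q mod p ℤ.+ r mod p [mod p ]
+-mod {q@record{}} {r@record{}} {p} q∈ r∈ = ≡ℤ-cancel p (b ℕ.* d) bd∤
  (≡ℤ-trans p
    (mod-unique {q ℚ.+ r} {p} (↥ q ℤ.* ↧ r ℤ.+ ↥ r ℤ.* ↧ q) (b ℕ.* d) bd∤ refl)
    (≡ℤ-trans p
      (≡ℤ-sym p (≡ℤ-+ p (≡ℤ-* p Q.num≡ (≡ℤ-reflexive p {↧ r} refl))
                        (≡ℤ-* p R.num≡ (≡ℤ-reflexive p {↧ q} refl))))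
      (≡ℤ-reflexive p (trans
        (solve 4 (λ x y b d → x :* b :* d :+ y :* d :* b := (x :+ y) :* (b :* d))
          refl (q mod p) (r mod p) (↧ q) (↧ r))
        (cong (ℤ._*_ (q mod p ℤ.+ r mod p)) (sym (ℤ.pos-* b d)))))))
  where
  open +-*-Solver
  module Q = Reduced {q} {p} q∈
  module R = Reduced {r} {p} r∈
  b = ↧ₙ q
  d = ↧ₙ r
  bd∤ : ¬ (proj₁ p ℕ.∣ b ℕ.* d)
  bd∤ = p∤* p b d Q.p∤ R.p∤

*-mod : ∀ {q r p} → q ∈ℤ₍ p ₎ → r ∈ℤ₍ p ₎ →
        (q ℚ.* r) mod p ≡ℤ (q mod p) ℤ.* (r mod p) [mod p ]
*-mod {q@record{}} {r@record{}} {p} q∈ r∈ = ≡ℤ-cancel p (b ℕ.* d) bd∤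
  (≡ℤ-trans p
    (mod-unique {q ℚ.* r} {p} (↥ q ℤ.* ↥ r) (b ℕ.* d) bd∤ refl)
    (≡ℤ-trans p
      (≡ℤ-sym p (≡ℤ-* p Q.num≡ R.num≡))
      (≡ℤ-reflexive p (trans
        (solve 4 (λ x y b d → (x :* b) :* (y :* d) := (x :* y) :* (b :* d))
          refl (q mod p) (r mod p) (↧ q) (↧ r))
        (cong (ℤ._*_ ((q mod p) ℤ.* (r mod p))) (sym (ℤ.pos-* b d)))))))
  where
  open +-*-Solver
  module Q = Reduced {q} {p} q∈
  module R = Reduced {r} {p} r∈
  b = ↧ₙ q
  d = ↧ₙ r
  bd∤ : ¬ (proj₁ p ℕ.∣ b ℕ.* d)
  bd∤ = p∤* p b d Q.p∤ R.p∤

neg-mod : ∀ {q p} → q ∈ℤ₍ p ₎ → (ℚ.- q) mod p ≡ℤ ℤ.- (q mod p) [mod p ]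
neg-mod {q} {p} q∈ = ≡ℤ-cancel p (↧ₙ q) Q.p∤
  (≡ℤ-trans p
    (mod-unique {ℚ.- q} {p} (ℤ.- (↥ q)) (↧ₙ q) Q.p∤ (-q≡ q))
    (≡ℤ-trans p (≡ℤ-neg p (≡ℤ-sym p Q.num≡))
      (≡ℤ-reflexive p (ℤ.neg-distribˡ-* (q mod p) (↧ q)))))
  where
  module Q = Reduced {q} {p} q∈
  -q≡ : ∀ q → ℚ.- q ≡ (ℤ.- (↥ q)) / ↧ₙ q
  -q≡ q@(ℚ.mkℚ ℤ.+0       _ _) = sym (ℚ.↥p/↧p≡p (ℚ.- q))
  -q≡ q@(ℚ.mkℚ ℤ.+[1+ _ ] _ _) = sym (ℚ.↥p/↧p≡p (ℚ.- q))
  -q≡ q@(ℚ.mkℚ ℤ.-[1+ _ ] _ _) = sym (ℚ.↥p/↧p≡p (ℚ.- q))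

-- Elements of 𝒜 = ∏ 𝔽ₚ / ⊕ 𝔽ₚ are families of representatives of residue
-- classes; two are equal when their difference vanishes in 𝔽ₚ for all but
-- finitely many p.
infix 4 _≈𝒜_

_≈𝒜_ : (α β : ℙ → ℤ) → Set
α ≈𝒜 β = FinitelyMany λ p → ¬ (α p ≡ℤ β p [mod p ])

private
  pointwise : ∀ {α β} → (∀ p → α p ≡ℤ β p [mod p ]) → α ≈𝒜 β
  pointwise h = [] , λ p ¬h → ⊥-elim (¬h (h p))

  laws : ∀ {α β} → (∀ p → α p ≡ β p) → α ≈𝒜 β
  laws h = pointwise λ p → ≡ℤ-reflexive p (h p)

  ≈𝒜-map : ∀ {α α′ β β′} →
            (∀ p → α p ≡ℤ α′ p [mod p ] → β p ≡ℤ β′ p [mod p ]) →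
            α ≈𝒜 α′ → β ≈𝒜 β′
  ≈𝒜-map h (ps , e) = ps , λ p ¬c → e p λ a → ¬c (h p a)

  ≈𝒜-zip : ∀ {α α′ β β′ γ γ′} →
            (∀ p → α p ≡ℤ α′ p [mod p ] → β p ≡ℤ β′ p [mod p ] → γ p ≡ℤ γ′ p [mod p ]) →
            α ≈𝒜 α′ → β ≈𝒜 β′ → γ ≈𝒜 γ′
  ≈𝒜-zip {α} {α′} h (ps , e) (qs , f) = ps ++ qs , go
    where
    go : ∀ p → _ → p ∈ ps ++ qs
    go p ¬c with _≡ℤ?_ p (α p) (α′ p)
    ... | no  ¬a = ∈-++⁺ˡ (e p ¬a)
    ... | yes a  = ∈-++⁺ʳ ps (f p λ b → ¬c (h p a b))

𝒜 : CommutativeRing 0ℓ 0ℓ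
𝒜 = record
  { Carrier = ℙ → ℤ
  ; _≈_ = _≈𝒜_
  ; _+_ = λ α β p → α p ℤ.+ β p
  ; _*_ = λ α β p → α p ℤ.* β p
  ; -_  = λ α p → ℤ.- α p
  ; 0#  = λ _ → + 0
  ; 1#  = λ _ → + 1
  ; isCommutativeRing = record
    { isRing = record
      { +-isAbelianGroup = record
        { isGroup = record
          { isMonoid = record
            { isSemigroup = record
              { isMagma = record
                { isEquivalence = ≈𝒜-isEquivalence
                ; ∙-cong = ≈𝒜-zip λ p → ≡ℤ-+ p }
              ; assoc = λ α β γ → laws λ p → ℤ.+-assoc (α p) (β p) (γ p) }
            ; identity = (λ α → laws λ p → ℤ.+-identityˡ (α p))
                       , (λ α → laws λ p → ℤ.+-identityʳ (α p)) }
          ; inverse = (λ α → laws λ p → ℤ.+-inverseˡ (α p))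
                    , (λ α → laws λ p → ℤ.+-inverseʳ (α p))
          ; ⁻¹-cong = ≈𝒜-map λ p → ≡ℤ-neg p }
        ; comm = λ α β → laws λ p → ℤ.+-comm (α p) (β p) }
      ; *-cong = ≈𝒜-zip λ p → ≡ℤ-* p
      ; *-assoc = λ α β γ → laws λ p → ℤ.*-assoc (α p) (β p) (γ p)
      ; *-identity = (λ α → laws λ p → ℤ.*-identityˡ (α p))
                   , (λ α → laws λ p → ℤ.*-identityʳ (α p))
      ; distrib = (λ α β γ → laws λ p → ℤ.*-distribˡ-+ (α p) (β p) (γ p))
                , (λ α β γ → laws λ p → ℤ.*-distribʳ-+ (α p) (β p) (γ p)) }
    ; *-comm = λ α β → laws λ p → ℤ.*-comm (α p) (β p) } }
  where
  ≈𝒜-isEquivalence : IsEquivalence _≈𝒜_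
  ≈𝒜-isEquivalence = record
    { refl  = laws λ _ → refl
    ; sym   = ≈𝒜-map λ p → ≡ℤ-sym p
    ; trans = ≈𝒜-zip λ p → ≡ℤ-trans p }

module 𝒜 = CommutativeRing 𝒜

_∈𝒜̃ : (ℙ → ℚ) → Set
a ∈𝒜̃ = FinitelyMany λ p → ¬ (a p ∈ℤ₍ p ₎)

image : (ℙ → ℚ) → 𝒜.Carrier
image a p = a p mod p

-- The structure map of 𝒜 as a ℚ-algebra; that it is a ring homomorphism is
-- fromℚ-isRingHomomorphism below.
fromℚ : ℚ → 𝒜.Carrier
fromℚ q = image λ _ → q

private
  primes≤ : ∀ n → FinitelyMany λ p → proj₁ p ℕ.≤ n
  primes≤ zero = [] , λ { (zero , pr) _ → ⊥-elim (ℕ.≢-nonZero⁻¹ 0 {{ℕ.nonTrivial⇒nonZero 0 {{prime⇒nonTrivial pr}}}} refl)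
                        ; (suc _ , _) () }
  primes≤ (suc n) with primes≤ n | prime? (suc n)
  ... | ps , h | yes pr = (suc n , pr) ∷ ps , λ p p≤ →
    [ (λ p<1+n → there (h p (ℕ.s≤s⁻¹ p<1+n))) , (λ { refl → here refl }) ]′ (ℕ.m≤n⇒m<n∨m≡n p≤)
  ... | ps , h | no ¬pr = ps , λ p p≤ →
    [ (λ p<1+n → h p (ℕ.s≤s⁻¹ p<1+n)) , (λ { refl → ⊥-elim (¬pr (proj₂ p)) }) ]′ (ℕ.m≤n⇒m<n∨m≡n p≤)

const∈𝒜̃ : ∀ q → (λ _ → q) ∈𝒜̃
const∈𝒜̃ q with primes≤ (↧ₙ q)
... | ps , h = ps , λ p q∉ → h p (ℕ.∣⇒≤ (decidable-stable (proj₁ p ℕ.∣? ↧ₙ q)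
                                          (λ p∤ → q∉ (p∤↧⇒∈ℤ₍₎ {q} {p} p∤))))

fromℚ-isRingHomomorphism :
  RingMorphisms.IsRingHomomorphism ℚ.+-*-rawRing 𝒜.rawRing fromℚ
fromℚ-isRingHomomorphism = record
  { isSemiringHomomorphism = record
    { isNearSemiringHomomorphism = record
      { +-isMonoidHomomorphism = record
        { isMagmaHomomorphism = record
          { isRelHomomorphism = record { cong = λ { refl → 𝒜.refl } }
          ; homo = λ q r → almost q r λ p → +-mod {q} {r} {p} }
        ; ε-homo = pointwise λ p → const-mod p (+ 0) }
      ; *-homo = λ q r → almost q r λ p → *-mod {q} {r} {p} }
    ; 1#-homo = pointwise λ p → const-mod p (+ 1) }
  ; -‿homo = λ q → almost q q λ p q∈ _ → neg-mod {q} {p} q∈ }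
  where
  almost : ∀ q r {α β} →
           (∀ p → q ∈ℤ₍ p ₎ → r ∈ℤ₍ p ₎ → α p ≡ℤ β p [mod p ]) → α ≈𝒜 β
  almost q r {α} {β} h with const∈𝒜̃ q | const∈𝒜̃ r
  ... | ps , e | qs , f = ps ++ qs , go
    where
    go : ∀ p → ¬ (α p ≡ℤ β p [mod p ]) → p ∈ ps ++ qs
    go p ¬c with q ∈ℤ₍ p ₎?
    ... | no  q∉ = ∈-++⁺ˡ (e p q∉)
    ... | yes q∈ = ∈-++⁺ʳ ps (f p λ r∈ → ¬c (h p q∈ r∈))

  const-mod : ∀ p z → ((z / 1) mod p) ≡ℤ z [mod p ]
  const-mod p z = ≡ℤ-trans p (≡ℤ-reflexive p (sym (ℤ.*-identityʳ _)))
    (mod-unique {z / 1} {p} z 1 p∤1 refl)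
    where
    p∤1 : ¬ (proj₁ p ℕ.∣ 1)
    p∤1 p∣1 = ℕ.<⇒≢ (ℕ.nonTrivial⇒n>1 (proj₁ p) {{prime⇒nonTrivial (proj₂ p)}}) (sym (ℕ.∣1⇒≡1 p∣1))

-- Polynomials over ℚ are lists of coefficients, constant term first;
-- trailing zeros are allowed.
ℚ[x] : Set
ℚ[x] = List ℚ

NonZeroPoly : ℚ[x] → Set
NonZeroPoly = Any (_≢ 0ℚ)

eval : ℚ[x] → 𝒜.Carrier → 𝒜.Carrier
eval []      α = 𝒜.0#
eval (c ∷ g) α = fromℚ c 𝒜.+ α 𝒜.* eval g α

NaivelyAlgebraic : 𝒜.Carrier → Set
NaivelyAlgebraic α = ∃[ g ] (NonZeroPoly g × eval g α 𝒜.≈ 𝒜.0#)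

NaivelyTranscendental : 𝒜.Carrier → Set
NaivelyTranscendental α = ¬ NaivelyAlgebraic α

-- The greatest odd divisor of m, for m positive. The default 1 passed to
-- max is itself an odd divisor.
u₂ : ℕ → ℕ
u₂ m = max 1 (filter (λ d → ¬? (2 ℕ.∣? d) ×-dec (d ℕ.∣? m)) (upTo (suc m)))

TS : ℤ → ℙ → ℤ
TS n (p , _) = n ℤ.^ ((u₂ (p ℕ.∸ 1) ℕ.+ 1) ℕ./ 2)

-- The Legendre symbol enters only through the condition (n/p) = -1, that n
-- is not congruent to a square; this never holds for p = 2.
QuadraticNonResidue : ℤ → ℙ → Set
QuadraticNonResidue n p = ¬ (∃[ x ] (n ≡ℤ x ℤ.* x [mod p ]))

IsResidualSquareRoot : ℤ → (ℙ → ℚ) → Set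
IsResidualSquareRoot n r =
  r ∈𝒜̃ ×
  ∃[ q ] (q ≢ 0ℚ × (∀ p →
    (QuadraticNonResidue n p → r p ≡ℚ q [mod p ]) ×
    (¬ QuadraticNonResidue n p → r p ℚ.* r p ≡ℚ n / 1 [mod p ])))

module Submission where

-- Suppose g(f(p)) ≡ 0 for almost all p, with g ≠ 0. Let q ∈ ℚ^× be the residue of TSₙ f at the
-- nonresidues, and w = n ^ u₂(p-1), so that TSₙ(p)² = n w; then f(p)² w is 1 or q²/n modulo p.
-- For every k, infinitely many primes divide N ^ m + 1 for N = |n| ^ 2ᵏ⁺¹ and some odd m, and at
-- those primes w ^ 2ᵏ⁺¹ ≡ -1, because the order of w is a power of 2. After clearing denominators,
-- the fourth power x of a fixed multiple of f satisfies x ^ 2ᵏ ≡ -e ^ 2ᵏ, where e > 0 is one of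
-- two numbers independent of p and k. Having infinitely many such congruences for every k is
-- incompatible with x being a root of one nonzero polynomial.

open import Defs
open import Data.Integer.Base using (ℤ; ∣_∣)
open import Data.Nat.Base using (_<_)
open import Data.Product.Base using (∃; _×_)
open import Data.Rational.Base using (ℚ; _/_; _*_)

open import Algebra.Properties.CommutativeSemiring.Binomial using (theorem; binomialTerm)
open import Data.Bool.Base using (Bool; true; false)
open import Data.Empty using (⊥-elim)
open import Data.Fin.Base using (Fin; zero; suc; toℕ; fromℕ; inject₁)
open import Data.Fin.Properties using (toℕ-fromℕ; toℕ-inject₁; toℕ<n)
open import Data.Integer.Base as ℤ
  using (+_; _+_; _-_; -_; _^_; 0ℤ; 1ℤ) renaming (_*_ to _·_)
open import Data.Integer.Divisibility.Signed
  using (_∣_; divides; ∣ᵤ⇒∣; ∣⇒∣ᵤ; ∣-refl; ∣m∣n⇒∣m-n; ∣m+n∣m⇒∣n; ∣m⇒∣m*n; ∣n⇒∣m*n)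
open import Data.Integer.Properties as ℤ using (_≟_)
open import Data.Integer.Tactic.RingSolver using (solve-∀)
open import Data.List.Base using (List; []; _∷_; filter; length; upTo)
open import Data.List.Extrema.Nat using (argmax-all; xs≤max)
open import Data.List.Membership.Propositional using (_∈_)
open import Data.List.Membership.Propositional.Properties using (∈-filter⁺; ∈-upTo⁺)
open import Data.List.Relation.Unary.All as All using (_∷_)
open import Data.List.Relation.Unary.All.Properties using (all-filter)
open import Data.List.Relation.Unary.Any using (here; there)
open import Data.Nat.Base as ℕ using (ℕ; zero; suc; NonZero)
open import Data.Nat.Combinatorics using (_C_; nCn≡1; nCk≡n!/k![n-k]!; k![n∸k]!∣n!)
open import Data.Nat.Coprimality using (Coprime; coprime-Bézout; coprime-divisor)
import Data.Nat.Divisibility as ℕ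
import Data.Nat.DivMod as ℕ
open import Data.Nat.GCD using (module Bézout)
open import Data.Nat.Induction using (<-wellFounded)
open import Data.Nat.ListAction using (product)
open import Data.Nat.Primality
  using (Prime; euclidsLemma; prime?; prime[2]; prime⇒irreducible; prime⇒nonTrivial; prime⇒nonZero)
open import Data.Nat.Primality.Factorisation using (factorise)
import Data.Nat.Properties as ℕ
import Data.Nat.Tactic.RingSolver as ℕ
open import Data.Product.Base using (∃-syntax; _,_; proj₁; proj₂)
open import Data.Rational.Base as ℚ using (0ℚ; ↥_; ↧_; ↧ₙ_)
import Data.Rational.Properties as ℚ
open import Data.Sum.Base as Sum using (_⊎_; [_,_]′; inj₁; inj₂)
open import Data.Vec.Base using (Vec; []; _∷_; _∷ʳ_; map; tail; zipWith)
open import Function.Base using (_∘_)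
open import Induction.WellFounded using (Acc; acc)
open import Relation.Binary.PropositionalEquality
  using (_≡_; _≢_; refl; sym; trans; cong; cong₂; subst; subst₂; module ≡-Reasoning)
open import Relation.Nullary using (¬_; yes; no; ¬?; _×-dec_)
open import Relation.Nullary.Decidable using (decidable-stable; toWitness; toWitnessFalse)

import Algebra.Properties.Semiring.Exp ℕ.+-*-semiring as Exp
import Algebra.Properties.Semiring.Mult ℕ.+-*-semiring as Mult
open import Algebra.Properties.Monoid.Sum ℕ.+-0-monoid using (sum; sum-init-last)

-- Divisibility and congruences modulo a prime

infix 4 _∣ᵖ_

_∣ᵖ_ : ℙ → ℤ → Set
p ∣ᵖ a = + proj₁ p ∣ a

euclid : ∀ p a {b} → p ∣ᵖ a · b → p ∣ᵖ a ⊎ p ∣ᵖ b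
euclid (p , p-prime) a {b} p∣ab = Sum.map ∣ᵤ⇒∣ ∣ᵤ⇒∣
  (euclidsLemma ∣ a ∣ ∣ b ∣ p-prime (subst (p ℕ.∣_) (ℤ.abs-* a b) (∣⇒∣ᵤ p∣ab)))

*-≢0 : ∀ {a b} → a ≢ 0ℤ → b ≢ 0ℤ → a · b ≢ 0ℤ
*-≢0 {a} a≢0 b≢0 ab≡0 = [ a≢0 , b≢0 ]′ (ℤ.i*j≡0⇒i≡0∨j≡0 a ab≡0)

^-≢0 : ∀ {a} k → a ≢ 0ℤ → a ^ k ≢ 0ℤ
^-≢0 {a} k a≢0 aᵏ≡0 = a≢0 (ℤ.i^n≡0⇒i≡0 a k aᵏ≡0)

pos-^ : ∀ m k → + (m ℕ.^ k) ≡ (+ m) ^ k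
pos-^ m zero    = refl
pos-^ m (suc k) = trans (ℤ.pos-* m (m ℕ.^ k)) (cong (+ m ·_) (pos-^ m k))

square-^ : ∀ x k → (x · x) ^ k ≡ x ^ (2 ℕ.* k)
square-^ x k = trans (cong (_^ k) (cong (x ·_) (sym (ℤ.*-identityʳ x)))) (ℤ.^-*-assoc x 2 k)

square-^ℕ : ∀ x k → (x ℕ.* x) ℕ.^ k ≡ x ℕ.^ (2 ℕ.* k)
square-^ℕ x k = trans (cong (ℕ._^ k) (cong (x ℕ.*_) (sym (ℕ.*-identityʳ x)))) (ℕ.^-*-assoc x 2 k)

neg-square : ∀ x → - x · - x ≡ x · x
neg-square = solve-∀

≡ℤ-^ : ∀ p {a b} k → a ≡ℤ b [mod p ] → a ^ k ≡ℤ b ^ k [mod p ]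
≡ℤ-^ p zero    a≡b = ≡ℤ-reflexive p refl
≡ℤ-^ p (suc k) a≡b = ≡ℤ-* p a≡b (≡ℤ-^ p k a≡b)

∣-resp-≡ℤ : ∀ p {a b} → a ≡ℤ b [mod p ] → p ∣ᵖ a → p ∣ᵖ b
∣-resp-≡ℤ p {a} {b} (congruent d) p∣a = subst (p ∣ᵖ_) (a-[a-b]≡b a b) (∣m∣n⇒∣m-n p∣a d)
  where
  a-[a-b]≡b : ∀ a b → a - (a - b) ≡ b
  a-[a-b]≡b = solve-∀

∣+⇒≡- : ∀ p a b → p ∣ᵖ a + b → a ≡ℤ - b [mod p ]
∣+⇒≡- p a b = congruent ∘ subst (λ c → p ∣ᵖ a + c) (sym (ℤ.neg-involutive b))

≡-⇒∣+ : ∀ p a b → a ≡ℤ - b [mod p ] → p ∣ᵖ a + b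
≡-⇒∣+ p a b (congruent d) = subst (λ c → p ∣ᵖ a + c) (ℤ.neg-involutive b) d

-- Integer polynomials: synthetic division and root squaring

⟦_⟧ : ∀ {d} → Vec ℤ d → ℤ → ℤ
⟦ []    ⟧ x = 0ℤ
⟦ c ∷ g ⟧ x = c + x · ⟦ g ⟧ x

⟦⟧-cong : ∀ p {d} (g : Vec ℤ d) {x y} → x ≡ℤ y [mod p ] → ⟦ g ⟧ x ≡ℤ ⟦ g ⟧ y [mod p ]
⟦⟧-cong p []      x≡y = ≡ℤ-reflexive p refl
⟦⟧-cong p (c ∷ g) x≡y = ≡ℤ-+ p (≡ℤ-reflexive p {c} refl) (≡ℤ-* p x≡y (⟦⟧-cong p g x≡y))

-- Horner's scheme: the coefficients of the quotient by x - r are the values at r of the successive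
-- tails of `g`. The length drops by one, which drives the recursion in `no-common-root`.
divide : ∀ {d} → Vec ℤ (suc d) → ℤ → Vec ℤ d
divide (_ ∷ [])        r = []
divide (_ ∷ g@(_ ∷ _)) r = ⟦ g ⟧ r ∷ divide g r

⟦divide⟧ : ∀ {d} (g : Vec ℤ (suc d)) r x →
           ⟦ g ⟧ x ≡ (x - r) · ⟦ divide g r ⟧ x + ⟦ g ⟧ r
⟦divide⟧ (c ∷ [])        r x = lemma c r x
  where
  lemma : ∀ c r x → c + x · 0ℤ ≡ (x - r) · 0ℤ + (c + r · 0ℤ)
  lemma = solve-∀
⟦divide⟧ (c ∷ g@(_ ∷ _)) r x =
  trans (cong (λ y → c + x · y) (⟦divide⟧ g r x)) (lemma c r x (⟦ divide g r ⟧ x) (⟦ g ⟧ r))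
  where
  lemma : ∀ c r x q v → c + x · ((x - r) · q + v) ≡ (x - r) · (v + x · q) + (c + r · v)
  lemma = solve-∀

-- Both parts are polynomials in x². They are padded with zeros to the length of the input, so that
-- `graeffe` can combine vectors entry by entry.
evenPart oddPart : ∀ {d} → Vec ℤ d → Vec ℤ d
evenPart []      = []
evenPart (c ∷ g) = c ∷ oddPart g
oddPart  []      = []
oddPart  (c ∷ g) = evenPart g ∷ʳ 0ℤ

⟦∷ʳ0⟧ : ∀ {d} (g : Vec ℤ d) x → ⟦ g ∷ʳ 0ℤ ⟧ x ≡ ⟦ g ⟧ x
⟦∷ʳ0⟧ []      x = trans (ℤ.+-identityˡ _) (ℤ.*-zeroʳ x)
⟦∷ʳ0⟧ (c ∷ g) x = cong (λ y → c + x · y) (⟦∷ʳ0⟧ g x)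

even+odd : ∀ {d} (g : Vec ℤ d) x → ⟦ g ⟧ x ≡ ⟦ evenPart g ⟧ (x · x) + x · ⟦ oddPart g ⟧ (x · x)
even+odd []      x = lemma x
  where
  lemma : ∀ x → 0ℤ ≡ 0ℤ + x · 0ℤ
  lemma = solve-∀
even+odd (c ∷ g) x rewrite ⟦∷ʳ0⟧ (evenPart g) (x · x) =
  trans (cong (λ y → c + x · y) (even+odd g x))
        (lemma c x (⟦ evenPart g ⟧ (x · x)) (⟦ oddPart g ⟧ (x · x)))
  where
  lemma : ∀ c x e o → c + x · (e + x · o) ≡ c + x · x · o + x · e
  lemma = solve-∀

⟦zipWith⟧ : ∀ s {d} (g h : Vec ℤ d) x →
            ⟦ zipWith (λ a b → s · a - b) g h ⟧ x ≡ s · ⟦ g ⟧ x - ⟦ h ⟧ x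
⟦zipWith⟧ s []      []      x = sym (trans (ℤ.+-identityʳ _) (ℤ.*-zeroʳ s))
⟦zipWith⟧ s (a ∷ g) (b ∷ h) x =
  trans (cong (λ y → s · a - b + x · y) (⟦zipWith⟧ s g h x)) (lemma s a b x (⟦ g ⟧ x) (⟦ h ⟧ x))
  where
  lemma : ∀ s a b x u v → s · a - b + x · (s · u - v) ≡ s · (a + x · u) - (b + x · v)
  lemma = solve-∀

-- Graeffe's root-squaring transform, from
-- (a + x h(x)) (a - x h(-x)) = a² + x² (2a o(x²) - h(x) h(-x)), o the odd part of h.
graeffe : ∀ {d} → Vec ℤ d → Vec ℤ d
graeffe []      = []
graeffe (a ∷ h) = a · a ∷ zipWith (λ o r → + 2 · a · o - r) (oddPart h) (graeffe h)

⟦graeffe⟧ : ∀ {d} (g : Vec ℤ d) x → ⟦ graeffe g ⟧ (x · x) ≡ ⟦ g ⟧ x · ⟦ g ⟧ (- x)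
⟦graeffe⟧ []      x = refl
⟦graeffe⟧ (a ∷ h) x = begin
  a · a + x · x · ⟦ zipWith (λ o r → + 2 · a · o - r) (oddPart h) (graeffe h) ⟧ (x · x)
    ≡⟨ cong (λ y → a · a + x · x · y) (⟦zipWith⟧ (+ 2 · a) (oddPart h) (graeffe h) (x · x)) ⟩
  a · a + x · x · (+ 2 · a · o - ⟦ graeffe h ⟧ (x · x))
    ≡⟨ cong (λ y → a · a + x · x · (+ 2 · a · o - y)) (⟦graeffe⟧ h x) ⟩
  a · a + x · x · (+ 2 · a · o - ⟦ h ⟧ x · ⟦ h ⟧ (- x))
    ≡⟨ cong₂ (λ y z → a · a + x · x · (+ 2 · a · o - y · z)) (even+odd h x) h[-x] ⟩
  a · a + x · x · (+ 2 · a · o - (e + x · o) · (e + - x · o))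
    ≡⟨ lemma a x e o ⟩
  (a + x · (e + x · o)) · (a + - x · (e + - x · o))
    ≡⟨ cong₂ (λ y z → (a + x · y) · (a + - x · z)) (sym (even+odd h x)) (sym h[-x]) ⟩
  (a + x · ⟦ h ⟧ x) · (a + - x · ⟦ h ⟧ (- x)) ∎
  where
  open ≡-Reasoning
  e o : ℤ
  e = ⟦ evenPart h ⟧ (x · x)
  o = ⟦ oddPart h ⟧ (x · x)
  h[-x] : ⟦ h ⟧ (- x) ≡ e + - x · o
  h[-x] = subst (λ y → ⟦ h ⟧ (- x) ≡ ⟦ evenPart h ⟧ y + - x · ⟦ oddPart h ⟧ y)
    (neg-square x) (even+odd h (- x))
  lemma : ∀ a x e o → a · a + x · x · (+ 2 · a · o - (e + x · o) · (e + - x · o)) ≡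
                      (a + x · (e + x · o)) · (a + - x · (e + - x · o))
  lemma = solve-∀

-- Descent on the degree

-- A finite set of primes to be avoided is given as the prime divisors of a nonzero integer.
Infinite : (ℙ → Set) → Set
Infinite S = ∀ D → D ≢ 0ℤ → ∃[ p ] (S p × ¬ p ∣ᵖ D)

AlmostAll : (ℙ → Set) → (ℙ → Set) → Set
AlmostAll S Q = ∃[ D ] (D ≢ 0ℤ × (∀ p → S p → ¬ p ∣ᵖ D → Q p))

-- The hypotheses are stable under squaring: x², e² and the sets `S (suc k)` satisfy them again.
-- `Bool` indexes two candidates because the one that occurs may vary with p.
module Descent (x : ℙ → ℤ) (e : Bool → ℕ) (S : ℕ → ℙ → Set)
  (e≢0 : ∀ i → e i ≢ 0) (S-infinite : ∀ k → Infinite (S k))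
  (powers : ∀ k p → S k p → ∃[ i ] p ∣ᵖ x p ^ (2 ℕ.^ k) + + (e i ℕ.^ (2 ℕ.^ k)))
  where

  shifted-powers : ∀ k p → S (suc k) p →
    ∃[ i ] p ∣ᵖ (x p · x p) ^ (2 ℕ.^ k) + + ((e i ℕ.* e i) ℕ.^ (2 ℕ.^ k))
  shifted-powers k p p∈S with powers (suc k) p p∈S
  ... | i , p∣ = i , subst₂ (λ a b → p ∣ᵖ a + + b)
    (sym (square-^ (x p) (2 ℕ.^ k))) (sym (square-^ℕ (e i) (2 ℕ.^ k))) p∣

  -- At level 0 the exponent is 1, so x ≡ -e i. If neither value were zero, some prime of `S 0`
  -- would divide neither of them nor `D`; yet it divides g(x) ≡ g(-e i).
  some-value-zero : ∀ {d} (g : Vec ℤ d) → AlmostAll (S 0) (λ p → p ∣ᵖ ⟦ g ⟧ (x p)) →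
                    ∃[ i ] ⟦ g ⟧ (- + e i) ≡ 0ℤ
  some-value-zero g (D , D≢0 , roots)
    with ⟦ g ⟧ (- + e true) ≟ 0ℤ | ⟦ g ⟧ (- + e false) ≟ 0ℤ
  ... | yes ≡0 | _      = true , ≡0
  ... | no _   | yes ≡0 = false , ≡0
  ... | no ≢₁  | no ≢₂
    with S-infinite 0 _ (*-≢0 D≢0 (*-≢0 ≢₁ ≢₂))
  ...   | p , p∈S , p∤ with powers 0 p p∈S
  ...     | i , p∣ = ⊥-elim (p∤ (p∣product i p∣value))
    where
    p∣value : p ∣ᵖ ⟦ g ⟧ (- + e i)
    p∣value = ∣-resp-≡ℤ p
      (⟦⟧-cong p g (∣+⇒≡- p _ _ (subst₂ (λ a b → p ∣ᵖ a + + b)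
        (ℤ.^-identityʳ (x p)) (ℕ.^-identityʳ (e i)) p∣)))
      (roots p p∈S (p∤ ∘ ∣m⇒∣m*n _))
    p∣product : ∀ i → p ∣ᵖ ⟦ g ⟧ (- + e i) →
                p ∣ᵖ D · (⟦ g ⟧ (- + e true) · ⟦ g ⟧ (- + e false))
    p∣product true  p∣v = ∣n⇒∣m*n D (∣m⇒∣m*n _ p∣v)
    p∣product false p∣v = ∣n⇒∣m*n D (∣n⇒∣m*n (⟦ g ⟧ (- + e true)) p∣v)

  -- Over S (suc k), x ≡ -e i would give x ^ 2ᵏ⁺¹ ≡ e i ^ 2ᵏ⁺¹, whereas it is ≡ -e j ^ 2ᵏ⁺¹.
  roots-of-cofactor : ∀ {d} (g : Vec ℤ (suc d)) i → ⟦ g ⟧ (- + e i) ≡ 0ℤ → ∀ k →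
    AlmostAll (S (suc k)) (λ p → p ∣ᵖ ⟦ g ⟧ (x p)) →
    AlmostAll (S (suc k)) (λ p → p ∣ᵖ ⟦ graeffe (divide g (- + e i)) ⟧ (x p · x p))
  roots-of-cofactor g i g[-e]≡0 k (D , D≢0 , roots) =
    D · + (sums true ℕ.* sums false) , *-≢0 D≢0 sums≢0 ,
    λ p p∈S p∤ → root p p∈S p∤ (powers (suc k) p p∈S)
    where
    K = 2 ℕ.^ suc k
    h = divide g (- + e i)
    -- The index j varies with p, so both obstructions enter the exceptional integer. Each is a sum
    -- of natural numbers with nonzero first term.
    sums : Bool → ℕ
    sums j = e i ℕ.^ K ℕ.+ e j ℕ.^ K
    sum≢0 : ∀ j → sums j ≢ 0
    sum≢0 j ≡0 = e≢0 i (ℕ.m^n≡0⇒m≡0 (e i) K (ℕ.m+n≡0⇒m≡0 (e i ℕ.^ K) ≡0))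
    sums≢0 : + (sums true ℕ.* sums false) ≢ 0ℤ
    sums≢0 ≡0 = [ sum≢0 true , sum≢0 false ]′ (ℕ.m*n≡0⇒m≡0∨n≡0 (sums true) (ℤ.+-injective ≡0))
    p∣sums : ∀ p j → p ∣ᵖ + sums j → p ∣ᵖ + (sums true ℕ.* sums false)
    p∣sums p j p∣ rewrite ℤ.pos-* (sums true) (sums false) with j
    ... | true  = ∣m⇒∣m*n _ p∣
    ... | false = ∣n⇒∣m*n (+ sums true) p∣
    root : ∀ p → S (suc k) p → ¬ p ∣ᵖ D · + (sums true ℕ.* sums false) →
           (∃[ j ] p ∣ᵖ x p ^ K + + (e j ℕ.^ K)) → p ∣ᵖ ⟦ graeffe h ⟧ (x p · x p)
    root p p∈S p∤ (j , p∣)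
      with euclid p (x p - - + e i) (subst (p ∣ᵖ_) (begin
             ⟦ g ⟧ (x p)
               ≡⟨ ⟦divide⟧ g (- + e i) (x p) ⟩
             (x p - - + e i) · ⟦ h ⟧ (x p) + ⟦ g ⟧ (- + e i)
               ≡⟨ cong (λ y → (x p - - + e i) · ⟦ h ⟧ (x p) + y) g[-e]≡0 ⟩
             (x p - - + e i) · ⟦ h ⟧ (x p) + 0ℤ
               ≡⟨ ℤ.+-identityʳ _ ⟩
             (x p - - + e i) · ⟦ h ⟧ (x p) ∎)
             (roots p p∈S (p∤ ∘ ∣m⇒∣m*n _)))
      where open ≡-Reasoning
    ... | inj₂ p∣h = subst (p ∣ᵖ_) (sym (⟦graeffe⟧ h (x p))) (∣m⇒∣m*n _ p∣h)
    ... | inj₁ d   = ⊥-elim (p∤ (∣n⇒∣m*n D (p∣sums p j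
      (∣-resp-≡ℤ p (≡ℤ-+ p xᴷ≡eᴷ (≡ℤ-reflexive p {+ (e j ℕ.^ K)} refl)) p∣))))
      where
      x≡-e : x p ≡ℤ - + e i [mod p ]
      x≡-e = congruent d
      xᴷ≡eᴷ : x p ^ K ≡ℤ + (e i ℕ.^ K) [mod p ]
      xᴷ≡eᴷ = subst₂ (_≡ℤ_[mod p ]) (square-^ (x p) (2 ℕ.^ k))
        (trans (cong (_^ (2 ℕ.^ k)) (neg-square (+ e i)))
          (trans (square-^ (+ e i) (2 ℕ.^ k)) (sym (pos-^ (e i) K))))
        (≡ℤ-^ p (2 ℕ.^ k) (≡ℤ-* p x≡-e x≡-e))

private
  c+r0≡c : ∀ c r → c + r · 0ℤ ≡ c
  c+r0≡c = solve-∀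

-- If g(-e) = 0, write g = (x + e) h; then h vanishes on the remaining S k, and its
-- Graeffe transform is a polynomial of smaller degree vanishing at the squares of the points.
no-common-root :
  ∀ {d} (g : Vec ℤ d) {c} (x : ℙ → ℤ) (e : Bool → ℕ) (S : ℕ → ℙ → Set) →
  c ≢ 0ℤ → (∀ i → e i ≢ 0) → (∀ k → Infinite (S k)) →
  (∀ k p → S k p → ∃[ i ] p ∣ᵖ x p ^ (2 ℕ.^ k) + + (e i ℕ.^ (2 ℕ.^ k))) →
  ¬ (∀ k → AlmostAll (S k) λ p → p ∣ᵖ ⟦ c ∷ g ⟧ (x p))
no-common-root g {c} x e S c≢0 e≢0 S-infinite powers roots
  with Descent.some-value-zero x e S e≢0 S-infinite powers (c ∷ g) (roots 0)
no-common-root [] {c} x e S c≢0 e≢0 S-infinite powers roots | i , g[-e]≡0 =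
  c≢0 (trans (sym (c+r0≡c c (- + e i))) g[-e]≡0)
no-common-root (b ∷ g) {c} x e S c≢0 e≢0 S-infinite powers roots | i , g[-e]≡0 =
  -- The transform of the quotient is, by computation, the square of `⟦ b ∷ g ⟧ (- + e i)` followed
  -- by this `tail`.
  no-common-root (tail (graeffe (divide (c ∷ b ∷ g) (- + e i))))
    (λ p → x p · x p) (λ j → e j ℕ.* e j) (λ k → S (suc k))
    (*-≢0 h[0]≢0 h[0]≢0)
    (λ j → [ e≢0 j , e≢0 j ]′ ∘ ℕ.m*n≡0⇒m≡0∨n≡0 (e j))
    (λ k → S-infinite (suc k))
    shifted-powers
    (λ k → roots-of-cofactor (c ∷ b ∷ g) i g[-e]≡0 k (roots (suc k)))
  where
  open Descent x e S e≢0 S-infinite powers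
  h[0]≢0 : ⟦ b ∷ g ⟧ (- + e i) ≢ 0ℤ
  -- The constant coefficient h[0] of the quotient satisfies c - e i · h[0] = g(-e i) = 0, so it
  -- inherits being nonzero from c.
  h[0]≢0 ≡0 = c≢0 (trans (sym (trans (cong (λ y → c + - + e i · y) ≡0)
    (c+r0≡c c (- + e i)))) g[-e]≡0)

-- Fermat's little theorem and the odd part of p - 1

prime∤1 : ∀ (p : ℙ) → ¬ proj₁ p ℕ.∣ 1
prime∤1 (p , p-prime) p∣1 =
  ℕ.<⇒≢ (ℕ.nonTrivial⇒n>1 p {{prime⇒nonTrivial p-prime}}) (sym (ℕ.∣1⇒≡1 p∣1))

prime∤! : ∀ (p : ℙ) k → k ℕ.< proj₁ p → ¬ proj₁ p ℕ.∣ k ℕ.!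
prime∤! p zero    _   = prime∤1 p
prime∤! p (suc k) k<p =
  [ (λ p∣k → ℕ.<⇒≱ k<p (ℕ.∣⇒≤ p∣k)) , prime∤! p k (ℕ.<-trans (ℕ.n<1+n k) k<p) ]′
  ∘ euclidsLemma (suc k) (k ℕ.!) (proj₂ p)

-- In C(p, k) · k! (p - k)! = p! the prime p divides the right side but neither factorial on the
-- left.
prime∣C : ∀ (p : ℙ) k → .{{NonZero k}} → k ℕ.< proj₁ p → proj₁ p ℕ.∣ proj₁ p C k
prime∣C (p , p-prime) k k<p =
  [ (λ d → d) , (λ p∣k![p-k]! → ⊥-elim
    ([ prime∤! (p , p-prime) k k<p , prime∤! (p , p-prime) (p ℕ.∸ k) p-k<p ]′
      (euclidsLemma (k ℕ.!) ((p ℕ.∸ k) ℕ.!) p-prime p∣k![p-k]!))) ]′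
  (euclidsLemma (p C k) (k ℕ.! ℕ.* (p ℕ.∸ k) ℕ.!) p-prime
    (subst (p ℕ.∣_) (sym C*k![p-k]!≡p!) (n∣n! p)))
  where
  instance
    _ = prime⇒nonZero p-prime
    _ = k ℕ.!* (p ℕ.∸ k) !≢0
  p-k<p : p ℕ.∸ k ℕ.< p
  p-k<p = ℕ.∸-monoʳ-< (ℕ.>-nonZero⁻¹ k) (ℕ.<⇒≤ k<p)
  n∣n! : ∀ n → .{{NonZero n}} → n ℕ.∣ n ℕ.!
  n∣n! (suc n) = ℕ.∣m⇒∣m*n (n ℕ.!) ℕ.∣-refl
  C*k![p-k]!≡p! : (p C k) ℕ.* (k ℕ.! ℕ.* (p ℕ.∸ k) ℕ.!) ≡ p ℕ.!
  C*k![p-k]!≡p! = trans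
    (cong (ℕ._* (k ℕ.! ℕ.* (p ℕ.∸ k) ℕ.!)) (nCk≡n!/k![n-k]! (ℕ.<⇒≤ k<p)))
    (ℕ.m/n*n≡m (k![n∸k]!∣n! (ℕ.<⇒≤ k<p)))

Exp-^ : ∀ x n → x Exp.^ n ≡ x ℕ.^ n
Exp-^ x zero    = refl
Exp-^ x (suc n) = cong (x ℕ.*_) (Exp-^ x n)

Mult-* : ∀ n x → n Mult.× x ≡ n ℕ.* x
Mult-* zero    x = refl
Mult-* (suc n) x = cong (x ℕ.+_) (Mult-* n x)

∣-sum : ∀ d {n} (t : Fin n → ℕ) → (∀ i → d ℕ.∣ t i) → d ℕ.∣ sum t
∣-sum d {zero}  t d∣t = d ℕ.∣0
∣-sum d {suc n} t d∣t = ℕ.∣m∣n⇒∣m+n (d∣t zero) (∣-sum d (t ∘ suc) (d∣t ∘ suc))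

-- In the binomial expansion the first term is a ^ p and the last is 1; all the others carry a
-- coefficient divisible by p.
[1+a]^p : ∀ (p : ℙ) a → ∃[ r ] (suc a ℕ.^ proj₁ p ≡ a ℕ.^ proj₁ p ℕ.+ (r ℕ.* proj₁ p ℕ.+ 1))
[1+a]^p (zero   , p-prime) a = ⊥-elim (ℕ.≢-nonZero⁻¹ 0 {{prime⇒nonZero p-prime}} refl)
[1+a]^p (suc p′ , p-prime) a = ℕ.quotient middle , (begin
  suc a ℕ.^ p                                ≡⟨ Exp-^ (suc a) p ⟨
  suc a Exp.^ p                              ≡⟨ theorem ℕ.+-*-commutativeSemiring p 1 a ⟩
  sum term                                   ≡⟨ cong (term zero ℕ.+_) (sum-init-last (term ∘ suc)) ⟩
  term zero ℕ.+ (sum (term ∘ suc ∘ inject₁) ℕ.+ term (suc (fromℕ p′)))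
    ≡⟨ cong₂ (λ u v → u ℕ.+ (sum (term ∘ suc ∘ inject₁) ℕ.+ v)) first last ⟩
  a ℕ.^ p ℕ.+ (sum (term ∘ suc ∘ inject₁) ℕ.+ 1)
    ≡⟨ cong (λ u → a ℕ.^ p ℕ.+ (u ℕ.+ 1)) (ℕ._∣_.equality middle) ⟩
  a ℕ.^ p ℕ.+ (ℕ.quotient middle ℕ.* p ℕ.+ 1) ∎)
  where
  open ≡-Reasoning
  p = suc p′
  term : Fin (suc p) → ℕ
  term = binomialTerm ℕ.+-*-commutativeSemiring 1 a p
  value : ∀ i → term i ≡ (p C toℕ i) ℕ.* (a ℕ.^ (p ℕ.∸ toℕ i))
  value i = trans (Mult-* (p C toℕ i) _) (cong ((p C toℕ i) ℕ.*_) (trans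
    (cong₂ ℕ._*_ (trans (Exp-^ 1 (toℕ i)) (ℕ.^-zeroˡ (toℕ i))) (Exp-^ a (p ℕ.∸ toℕ i)))
    (ℕ.*-identityˡ _)))
  first : term zero ≡ a ℕ.^ p
  first = trans (value zero) (ℕ.*-identityˡ _)
  last : term (suc (fromℕ p′)) ≡ 1
  last = trans (value (suc (fromℕ p′))) (begin
    (p C suc (toℕ (fromℕ p′))) ℕ.* a ℕ.^ (p′ ℕ.∸ toℕ (fromℕ p′))
      ≡⟨ cong (λ k → (p C suc k) ℕ.* a ℕ.^ (p′ ℕ.∸ k)) (toℕ-fromℕ p′) ⟩
    (p C p) ℕ.* a ℕ.^ (p′ ℕ.∸ p′)
      ≡⟨ cong₂ (λ u v → u ℕ.* a ℕ.^ v) (nCn≡1 p) (ℕ.n∸n≡0 p′) ⟩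
    1 ∎)
  middle : p ℕ.∣ sum (term ∘ suc ∘ inject₁)
  middle = ∣-sum p _ λ i → subst (p ℕ.∣_) (sym (value (suc (inject₁ i))))
    (ℕ.∣m⇒∣m*n _ (prime∣C (p , p-prime) (suc (toℕ (inject₁ i)))
      (ℕ.s≤s (subst (ℕ._< p′) (sym (toℕ-inject₁ i)) (toℕ<n i)))))

module _ (p : ℙ) where

  private
    P = proj₁ p

    suc-pred-P : suc (P ℕ.∸ 1) ≡ P
    suc-pred-P = ℕ.m+[n∸m]≡n (ℕ.>-nonZero⁻¹ P {{prime⇒nonZero (proj₂ p)}})

  a^p≡a : ∀ a → (+ a) ^ P ≡ℤ + a [mod p ]
  a^p≡a zero    = ≡ℤ-reflexive p (cong (0ℤ ^_) (sym suc-pred-P))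
  a^p≡a (suc a) with [1+a]^p p a
  ... | r , eq = ≡ℤ-trans p (congruent (divides (+ r) (begin
      (+ suc a) ^ P - ((+ a) ^ P + 1ℤ)
        ≡⟨ cong (_- ((+ a) ^ P + 1ℤ)) (trans (sym (pos-^ (suc a) P)) (cong +_ eq)) ⟩
      + (a ℕ.^ P) + (+ (r ℕ.* P) + 1ℤ) - ((+ a) ^ P + 1ℤ)
        ≡⟨ cong₂ (λ x y → x + (y + 1ℤ) - ((+ a) ^ P + 1ℤ)) (pos-^ a P) (ℤ.pos-* r P) ⟩
      (+ a) ^ P + (+ r · + P + 1ℤ) - ((+ a) ^ P + 1ℤ)
        ≡⟨ cancel ((+ a) ^ P) (+ r · + P) ⟩
      + r · + P ∎)))
    (≡ℤ-trans p (≡ℤ-+ p (a^p≡a a) (≡ℤ-reflexive p {1ℤ} refl)) (≡ℤ-reflexive p (ℤ.+-comm (+ a) 1ℤ)))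
    where
    open ≡-Reasoning
    cancel : ∀ x y → x + (y + 1ℤ) - (x + 1ℤ) ≡ y
    cancel = solve-∀

  fermat : ∀ a → ¬ P ℕ.∣ a → (+ a) ^ (P ℕ.∸ 1) ≡ℤ 1ℤ [mod p ]
  fermat a p∤a = ≡ℤ-cancel p a p∤a (≡ℤ-trans p
    (≡ℤ-reflexive p (trans (ℤ.*-comm ((+ a) ^ (P ℕ.∸ 1)) (+ a)) (cong ((+ a) ^_) suc-pred-P)))
    (≡ℤ-trans p (a^p≡a a) (≡ℤ-reflexive p (sym (ℤ.*-identityˡ (+ a))))))

  power-≡1 : ∀ {x} m k → x ^ m ≡ℤ 1ℤ [mod p ] → x ^ (k ℕ.* m) ≡ℤ 1ℤ [mod p ]
  power-≡1 {x} m k xᵐ≡1 = ≡ℤ-trans p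
    (≡ℤ-reflexive p (trans (cong (x ^_) (ℕ.*-comm k m)) (sym (ℤ.^-*-assoc x m k))))
    (≡ℤ-trans p (≡ℤ-^ p k xᵐ≡1) (≡ℤ-reflexive p (ℤ.^-zeroˡ k)))

  consecutive-powers-≡1 : ∀ {x} k → x ^ k ≡ℤ 1ℤ [mod p ] → x ^ suc k ≡ℤ 1ℤ [mod p ] →
                          x ≡ℤ 1ℤ [mod p ]
  consecutive-powers-≡1 {x} k xᵏ≡1 xᵏ⁺¹≡1 = ≡ℤ-trans p
    (≡ℤ-reflexive p (sym (ℤ.*-identityʳ x)))
    (≡ℤ-trans p (≡ℤ-* p (≡ℤ-reflexive p {x} refl) (≡ℤ-sym p xᵏ≡1)) xᵏ⁺¹≡1)

  -- Bézout over ℕ yields a multiple of m and a multiple of n differing by one. Both powers are ≡ 1,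
  -- and the larger is x times the smaller.
  coprime-powers-≡1 : ∀ {x} m n → Coprime m n →
    x ^ m ≡ℤ 1ℤ [mod p ] → x ^ n ≡ℤ 1ℤ [mod p ] → x ≡ℤ 1ℤ [mod p ]
  coprime-powers-≡1 {x} m n coprime xᵐ≡1 xⁿ≡1 with coprime-Bézout coprime
  ... | Bézout.+- y z eq = consecutive-powers-≡1 (z ℕ.* n) (power-≡1 n z xⁿ≡1)
    (subst (λ l → x ^ l ≡ℤ 1ℤ [mod p ]) (sym eq) (power-≡1 m y xᵐ≡1))
  ... | Bézout.-+ y z eq = consecutive-powers-≡1 (y ℕ.* m) (power-≡1 m y xᵐ≡1)
    (subst (λ l → x ^ l ≡ℤ 1ℤ [mod p ]) (sym eq) (power-≡1 n z xⁿ≡1))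

Odd : ℕ → Set
Odd m = ¬ 2 ℕ.∣ m

odd-* : ∀ {m n} → Odd m → Odd n → Odd (m ℕ.* n)
odd-* {m} {n} odd-m odd-n = [ odd-m , odd-n ]′ ∘ euclidsLemma m n prime[2]

odd-^ : ∀ {m} k → Odd m → Odd (m ℕ.^ k)
odd-^ zero    odd-m = prime∤1 (2 , prime[2])
odd-^ (suc k) odd-m = odd-* odd-m (odd-^ k odd-m)

neg-^-odd : ∀ x m → Odd m → (- x) ^ m ≡ - (x ^ m)
neg-^-odd x zero          odd-m = ⊥-elim (odd-m (2 ℕ.∣0))
neg-^-odd x (suc zero)    odd-m = lemma x
  where
  lemma : ∀ x → - x · 1ℤ ≡ - (x · 1ℤ)
  lemma = solve-∀
neg-^-odd x (suc (suc m)) odd-m = trans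
  (cong (λ y → - x · (- x · y)) (neg-^-odd x m (odd-m ∘ ℕ.∣m∣n⇒∣m+n ℕ.∣-refl)))
  (lemma x (x ^ m))
  where
  lemma : ∀ x y → - x · (- x · - y) ≡ - (x · (x · y))
  lemma = solve-∀

odd-coprime-2^ : ∀ {m} v → Odd m → Coprime m (2 ℕ.^ v)
odd-coprime-2^ {m} zero    odd-m (d∣m , d∣1)  = ℕ.∣1⇒≡1 d∣1
odd-coprime-2^ {m} (suc v) odd-m {d} (d∣m , d∣2ᵛ⁺¹) =
  odd-coprime-2^ v odd-m (d∣m , coprime-divisor d-coprime-2 d∣2ᵛ⁺¹)
  where
  d-coprime-2 : Coprime d 2
  d-coprime-2 (i∣d , i∣2) = [ (λ eq → eq) , (λ { refl → ⊥-elim (odd-m (ℕ.∣-trans i∣d d∣m)) }) ]′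
    (prime⇒irreducible prime[2] i∣2)

odd-part : ∀ n → .{{NonZero n}} → ∃[ v ] ∃[ m ] (n ≡ 2 ℕ.^ v ℕ.* m × Odd m)
odd-part n = go n (<-wellFounded n)
  where
  go : ∀ n → .{{NonZero n}} → Acc ℕ._<_ n → ∃[ v ] ∃[ m ] (n ≡ 2 ℕ.^ v ℕ.* m × Odd m)
  go n (acc rec) with 2 ℕ.∣? n
  ... | no  odd-n = 0 , n , sym (ℕ.*-identityˡ n) , odd-n
  ... | yes 2∣n@(ℕ.divides q n≡q*2)
    with go q {{ℕ.quotient≢0 2∣n}} (rec (ℕ.quotient-< 2∣n))
  ...   | v , m , q≡ , odd-m = suc v , m , (begin
    n                      ≡⟨ n≡q*2 ⟩
    q ℕ.* 2                ≡⟨ ℕ.*-comm q 2 ⟩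
    2 ℕ.* q                ≡⟨ cong (2 ℕ.*_) q≡ ⟩
    2 ℕ.* (2 ℕ.^ v ℕ.* m)  ≡⟨ ℕ.*-assoc 2 (2 ℕ.^ v) m ⟨
    2 ℕ.^ suc v ℕ.* m      ∎) , odd-m
    where open ≡-Reasoning

module _ (n : ℕ) .{{_ : NonZero n}} where

  private
    odd-divisor? = λ d → ¬? (2 ℕ.∣? d) ×-dec (d ℕ.∣? n)

    u₂-odd-divisor : Odd (u₂ n) × u₂ n ℕ.∣ n
    u₂-odd-divisor = argmax-all (λ d → d) {P = λ d → Odd d × d ℕ.∣ n}
      -- `max` may return its default 1, so the property is checked for 1 as well.
      (prime∤1 (2 , prime[2]) , ℕ.1∣ n) (all-filter odd-divisor? (upTo (suc n)))

    u₂-greatest : ∀ d → Odd d → d ℕ.∣ n → d ℕ.≤ u₂ n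
    u₂-greatest d odd-d d∣n = All.lookup (xs≤max 1 (filter odd-divisor? (upTo (suc n))))
      (∈-filter⁺ odd-divisor? (∈-upTo⁺ (ℕ.s≤s (ℕ.∣⇒≤ d∣n))) (odd-d , d∣n))

  u₂-odd : Odd (u₂ n)
  u₂-odd = proj₁ u₂-odd-divisor

  -- Write n = u₂ n · 2ᵛ m with m odd. Then u₂ n · m is again an odd divisor of n, so maximality
  -- forces m = 1.
  u₂*2^v : ∃[ v ] n ≡ u₂ n ℕ.* 2 ℕ.^ v
  u₂*2^v with odd-part (ℕ.quotient u₂∣n) {{ℕ.quotient≢0 u₂∣n}}
    where u₂∣n = proj₂ u₂-odd-divisor
  ... | v , m , q≡ , odd-m = v , (begin
    n                             ≡⟨ n≡um*2ᵛ ⟩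
    (u₂ n ℕ.* m) ℕ.* 2 ℕ.^ v      ≡⟨ cong (λ k → (u₂ n ℕ.* k) ℕ.* 2 ℕ.^ v) m≡1 ⟩
    (u₂ n ℕ.* 1) ℕ.* 2 ℕ.^ v      ≡⟨ cong (ℕ._* 2 ℕ.^ v) (ℕ.*-identityʳ (u₂ n)) ⟩
    u₂ n ℕ.* 2 ℕ.^ v              ∎)
    where
    open ≡-Reasoning
    n≡um*2ᵛ : n ≡ (u₂ n ℕ.* m) ℕ.* 2 ℕ.^ v
    n≡um*2ᵛ = trans (ℕ._∣_.equality (proj₂ u₂-odd-divisor))
      (trans (cong (ℕ._* u₂ n) q≡) (lemma (2 ℕ.^ v) m (u₂ n)))
      where
      lemma : ∀ x y z → x ℕ.* y ℕ.* z ≡ z ℕ.* y ℕ.* x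
      lemma = ℕ.solve-∀
    instance
      u≢0 : NonZero (u₂ n)
      u≢0 = ℕ.≢-nonZero λ u≡0 → u₂-odd (subst (2 ℕ.∣_) (sym u≡0) (2 ℕ.∣0))
    um≤u : u₂ n ℕ.* m ℕ.≤ u₂ n ℕ.* 1
    um≤u = subst (u₂ n ℕ.* m ℕ.≤_) (sym (ℕ.*-identityʳ (u₂ n)))
      (u₂-greatest (u₂ n ℕ.* m) (odd-* u₂-odd odd-m)
        (subst (u₂ n ℕ.* m ℕ.∣_) (sym n≡um*2ᵛ) (ℕ.∣m⇒∣m*n _ ℕ.∣-refl)))
    m≡1 : m ≡ 1
    m≡1 = ℕ.≤-antisym (ℕ.*-cancelˡ-≤ (u₂ n) um≤u)
      (ℕ.n≢0⇒n>0 λ { refl → odd-m (2 ℕ.∣0) })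

-- Primes dividing odd powers plus one

predecessor-nonZero : ∀ (p : ℙ) → NonZero (proj₁ p ℕ.∸ 1)
predecessor-nonZero (p , p-prime) =
  ℕ.>-nonZero (ℕ.m<n⇒0<n∸m (ℕ.nonTrivial⇒n>1 p {{prime⇒nonTrivial p-prime}}))

module _ (p : ℙ) where

  private
    P = proj₁ p

  power-+1 : ∀ {x} k m → Odd k → p ∣ᵖ x ^ m + 1ℤ → p ∣ᵖ x ^ (k ℕ.* m) + 1ℤ
  power-+1 {x} k m odd-k p∣ = ≡-⇒∣+ p _ _ (≡ℤ-trans p
    (≡ℤ-reflexive p (trans (cong (x ^_) (ℕ.*-comm k m)) (sym (ℤ.^-*-assoc x m k))))
    (≡ℤ-trans p (≡ℤ-^ p k (∣+⇒≡- p (x ^ m) 1ℤ p∣))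
      (≡ℤ-reflexive p (trans (neg-^-odd 1ℤ k odd-k) (cong -_ (ℤ.^-zeroˡ k))))))

  ∣base⇒∤power+1 : ∀ {x} m → Odd m → p ∣ᵖ x → ¬ p ∣ᵖ x ^ m + 1ℤ
  ∣base⇒∤power+1 zero    odd-m _ _ = odd-m (2 ℕ.∣0)
  ∣base⇒∤power+1 {x} (suc m) _ p∣x p∣ =
    prime∤1 p (∣⇒∣ᵤ {+ P} {1ℤ} (∣m+n∣m⇒∣n p∣ (∣m⇒∣m*n (x ^ m) p∣x)))

  -- -(a ^ u) has odd order dividing m and, by Fermat, order a power of 2.
  power-odd-part : ∀ a m u v → P ℕ.∸ 1 ≡ u ℕ.* 2 ℕ.^ v → Odd u → Odd m →
                   p ∣ᵖ (+ a) ^ m + 1ℤ → p ∣ᵖ (+ a) ^ u + 1ℤ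
  power-odd-part a m u v P-1≡ odd-u odd-m p∣ = ≡-⇒∣+ p b 1ℤ (≡ℤ-trans p
    (≡ℤ-reflexive p (sym (ℤ.neg-involutive b)))
    (≡ℤ-neg p (coprime-powers-≡1 p {x = - b} m (2 ℕ.^ suc v) (odd-coprime-2^ (suc v) odd-m)
      [-b]ᵐ≡1 [-b]²ᵛ≡1)))
    where
    b = (+ a) ^ u
    [-b]ᵐ≡1 : (- b) ^ m ≡ℤ 1ℤ [mod p ]
    [-b]ᵐ≡1 = ≡ℤ-trans p
      (≡ℤ-reflexive p (trans (neg-^-odd b m odd-m)
        (cong -_ (ℤ.^-*-assoc (+ a) u m))))
      (≡ℤ-neg p (∣+⇒≡- p ((+ a) ^ (u ℕ.* m)) 1ℤ (power-+1 {+ a} u m odd-u p∣)))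
    -- The exponent 2 ^ `suc v` is even also when v = 0, as happens for p = 2, so the sign always
    -- disappears; what remains is the square of Fermat's congruence.
    [-b]²ᵛ≡1 : (- b) ^ (2 ℕ.^ suc v) ≡ℤ 1ℤ [mod p ]
    [-b]²ᵛ≡1 = ≡ℤ-trans p (≡ℤ-reflexive p eq)
      (power-≡1 p (P ℕ.∸ 1) 2 (fermat p a λ P∣a →
        ∣base⇒∤power+1 {+ a} m odd-m (∣ᵤ⇒∣ P∣a) p∣))
      where
      open ≡-Reasoning
      eq : (- b) ^ (2 ℕ.^ suc v) ≡ (+ a) ^ (2 ℕ.* (P ℕ.∸ 1))
      eq = begin
        (- b) ^ (2 ℕ.* 2 ℕ.^ v)          ≡⟨ square-^ (- b) (2 ℕ.^ v) ⟨
        (- b · - b) ^ (2 ℕ.^ v)          ≡⟨ cong (_^ (2 ℕ.^ v)) (neg-square b) ⟩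
        (b · b) ^ (2 ℕ.^ v)              ≡⟨ square-^ b (2 ℕ.^ v) ⟩
        b ^ (2 ℕ.* 2 ℕ.^ v)              ≡⟨ ℤ.^-*-assoc (+ a) u (2 ℕ.* 2 ℕ.^ v) ⟩
        (+ a) ^ (u ℕ.* (2 ℕ.* 2 ℕ.^ v))  ≡⟨ cong ((+ a) ^_) (lemma u (2 ℕ.^ v)) ⟩
        (+ a) ^ (2 ℕ.* (u ℕ.* 2 ℕ.^ v))  ≡⟨ cong (λ k → (+ a) ^ (2 ℕ.* k)) P-1≡ ⟨
        (+ a) ^ (2 ℕ.* (P ℕ.∸ 1))        ∎
        where
        lemma : ∀ x y → x ℕ.* (2 ℕ.* y) ≡ 2 ℕ.* (x ℕ.* y)
        lemma = ℕ.solve-∀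

  power-u₂ : ∀ a m → Odd m → p ∣ᵖ (+ a) ^ m + 1ℤ → p ∣ᵖ (+ a) ^ u₂ (P ℕ.∸ 1) + 1ℤ
  power-u₂ a m = power-odd-part a m (u₂ (P ℕ.∸ 1)) (proj₁ factored) (proj₂ factored)
                   (u₂-odd (P ℕ.∸ 1))
    where
    instance
      P-1≢0 : NonZero (P ℕ.∸ 1)
      P-1≢0 = predecessor-nonZero p
    factored = u₂*2^v (P ℕ.∸ 1)

prime-divisor : ∀ n → 1 ℕ.< n → ∃[ p ] proj₁ {B = Prime} p ℕ.∣ n
prime-divisor n@(suc _) 1<n with factorise n
... | record { factors = [] ; isFactorisation = refl } = ⊥-elim (ℕ.<-irrefl refl 1<n)
... | record { factors = q ∷ qs ; isFactorisation = n≡ ; factorsPrime = q-prime ∷ _ } =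
  (q , q-prime) , subst (q ℕ.∣_) (sym n≡) (ℕ.∣m⇒∣m*n (product qs) ℕ.∣-refl)

3∤1+3* : ∀ t → ¬ 3 ℕ.∣ 1 ℕ.+ 3 ℕ.* t
3∤1+3* t 3∣ = 3≢1 (ℕ.∣1⇒≡1 (ℕ.∣m+n∣m⇒∣n
  (subst (3 ℕ.∣_) (ℕ.+-comm 1 (3 ℕ.* t)) 3∣) (ℕ.∣m⇒∣m*n t ℕ.∣-refl)))
  where
  3≢1 : 3 ≢ 1
  3≢1 ()

-- c² + c + 1 = b² - b + 1 for b = c + 1; it exceeds 3 and is not divisible by 9.
prime≢3-divisor : ∀ c → 3 ℕ.≤ c →
  ∃[ p ] (¬ proj₁ p ℕ.∣ 3 × proj₁ {B = Prime} p ℕ.∣ c ℕ.* c ℕ.+ c ℕ.+ 1)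
prime≢3-divisor c 3≤c = by-residue (c ℕ.% 3) (c ℕ./ 3) (ℕ.m%n<n c 3) (ℕ.m≡m%n+[m/n]*n c 3)
  where
  N : ℕ → ℕ
  N c = c ℕ.* c ℕ.+ c ℕ.+ 1
  Goal : Set
  Goal = ∃[ p ] (¬ proj₁ p ℕ.∣ 3 × proj₁ {B = Prime} p ℕ.∣ N c)
  from : ∀ M → ¬ 3 ℕ.∣ M → 1 ℕ.< M → M ℕ.∣ N c → Goal
  from M 3∤M 1<M M∣N with prime-divisor M 1<M
  ... | p@(q , q-prime) , q∣M =
    p , (λ q∣3 → 3∤M (subst (ℕ._∣ M) (q≡3 q∣3) q∣M)) , ℕ.∣-trans q∣M M∣N
    where
    prime[3] : Prime 3
    prime[3] = toWitness {a? = prime? 3} _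
    q≡3 : q ℕ.∣ 3 → q ≡ 3
    q≡3 q∣3 = [ (λ { refl → ⊥-elim (prime∤1 p ℕ.∣-refl) }) , (λ eq → eq) ]′
      (prime⇒irreducible prime[3] q∣3)
  1<N : 1 ℕ.< N c
  1<N = ℕ.+-monoˡ-≤ 1 (ℕ.≤-trans (ℕ.≤-trans (ℕ.s≤s ℕ.z≤n) 3≤c) (ℕ.m≤n+m c (c ℕ.* c)))
  coprime-to-3 : ∀ M → N c ≡ 1 ℕ.+ 3 ℕ.* M → Goal
  coprime-to-3 M N≡ = from (N c) (3∤1+3* M ∘ subst (3 ℕ.∣_) N≡) 1<N ℕ.∣-refl
  by-residue : ∀ r t → r ℕ.< 3 → c ≡ r ℕ.+ t ℕ.* 3 → Goal
  by-residue 0 t _ c≡ = coprime-to-3 (t ℕ.* (3 ℕ.* t ℕ.+ 1)) (trans (cong N c≡) (lemma t))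
    where
    lemma : ∀ t → t ℕ.* 3 ℕ.* (t ℕ.* 3) ℕ.+ t ℕ.* 3 ℕ.+ 1 ≡ 1 ℕ.+ 3 ℕ.* (t ℕ.* (3 ℕ.* t ℕ.+ 1))
    lemma = ℕ.solve-∀
  -- For c = 1 + 3t the factor 3 splits off exactly once. The cofactor exceeds 1 as soon as t > 0,
  -- and t = 0 would mean c = 1.
  by-residue 1 zero      _ refl = ⊥-elim (ℕ.<⇒≱ (ℕ.s≤s (ℕ.s≤s ℕ.z≤n)) 3≤c)
  by-residue 1 t@(suc _) _ c≡ =
    from (1 ℕ.+ 3 ℕ.* (t ℕ.* (t ℕ.+ 1))) (3∤1+3* (t ℕ.* (t ℕ.+ 1)))
      (ℕ.s≤s (ℕ.s≤s ℕ.z≤n)) (ℕ.divides 3 (trans (cong N c≡) (lemma t)))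
    where
    lemma : ∀ t → (1 ℕ.+ t ℕ.* 3) ℕ.* (1 ℕ.+ t ℕ.* 3) ℕ.+ (1 ℕ.+ t ℕ.* 3) ℕ.+ 1 ≡
                  3 ℕ.* (1 ℕ.+ 3 ℕ.* (t ℕ.* (t ℕ.+ 1)))
    lemma = ℕ.solve-∀
  by-residue 2 t _ c≡ = coprime-to-3 (2 ℕ.+ t ℕ.* (3 ℕ.* t ℕ.+ 5)) (trans (cong N c≡) (lemma t))
    where
    lemma : ∀ t → (2 ℕ.+ t ℕ.* 3) ℕ.* (2 ℕ.+ t ℕ.* 3) ℕ.+ (2 ℕ.+ t ℕ.* 3) ℕ.+ 1 ≡
                  1 ℕ.+ 3 ℕ.* (2 ℕ.+ t ℕ.* (3 ℕ.* t ℕ.+ 5))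
    lemma = ℕ.solve-∀
  by-residue (suc (suc (suc _))) _ (ℕ.s≤s (ℕ.s≤s (ℕ.s≤s ()))) _

-- The primes p_j ≠ 3 dividing b² - b + 1 for b = a ^ 3ʲ are pairwise distinct: p_j divides b³ + 1,
-- so a ^ 3ⁱ ≡ -1 mod p_j for i > j, where b² - b + 1 takes the value 3.
module _ (a : ℕ) (4≤a : 4 ℕ.≤ a) where

  private
    b : ℕ → ℤ
    b j = (+ a) ^ (3 ℕ.^ j)

    N : ℕ → ℤ
    N j = b j · b j - b j + 1ℤ

    -- Shifting by one turns b² - b + 1 into c² + c + 1, which avoids subtraction in ℕ.
    b≡ : ∀ j → ∃[ c ] (3 ℕ.≤ c × b j ≡ + (suc c))
    b≡ j = c (a ℕ.^ (3 ℕ.^ j)) 4≤b (sym (pos-^ a (3 ℕ.^ j)))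
      where
      c : ∀ m → 4 ℕ.≤ m → b j ≡ + m → ∃[ c ] (3 ℕ.≤ c × b j ≡ + (suc c))
      c (suc m) (ℕ.s≤s 3≤m) eq = m , 3≤m , eq
      instance
        a≢0 : NonZero a
        a≢0 = ℕ.>-nonZero (ℕ.≤-trans (ℕ.s≤s ℕ.z≤n) 4≤a)
      4≤b : 4 ℕ.≤ a ℕ.^ (3 ℕ.^ j)
      4≤b = ℕ.≤-trans 4≤a (subst (ℕ._≤ a ℕ.^ (3 ℕ.^ j)) (ℕ.^-identityʳ a)
        (ℕ.^-monoʳ-≤ a (ℕ.m^n>0 3 j)))

    divisor-of-N : ∀ j → ∃[ p ] (¬ proj₁ p ℕ.∣ 3 × p ∣ᵖ N j)
    divisor-of-N j with b≡ j
    ... | c , 3≤c , b≡1+c with prime≢3-divisor c 3≤c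
    ...   | p , p∤3 , p∣ = p , p∤3 , subst (p ∣ᵖ_) (begin
      + (c ℕ.* c ℕ.+ c ℕ.+ 1)                 ≡⟨ cong (λ x → x + + c + 1ℤ) (ℤ.pos-* c c) ⟩
      + c · + c + + c + 1ℤ                    ≡⟨ lemma (+ c) ⟩
      (1ℤ + + c) · (1ℤ + + c) - (1ℤ + + c) + 1ℤ ≡⟨ cong (λ x → x · x - x + 1ℤ) b≡1+c ⟨
      N j                                     ∎) (∣ᵤ⇒∣ p∣)
      where
      open ≡-Reasoning
      lemma : ∀ c → c · c + c + 1ℤ ≡ (1ℤ + c) · (1ℤ + c) - (1ℤ + c) + 1ℤ
      lemma = solve-∀

    ∣N⇒∣b+1 : ∀ p j → p ∣ᵖ N j → p ∣ᵖ b (suc j) + 1ℤ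
    ∣N⇒∣b+1 p j p∣N = subst (p ∣ᵖ_) (trans (lemma (b j)) (cong (_+ 1ℤ) (trans
      (ℤ.^-*-assoc (+ a) (3 ℕ.^ j) 3) (cong ((+ a) ^_) (ℕ.*-comm (3 ℕ.^ j) 3)))))
      (∣n⇒∣m*n (b j + 1ℤ) p∣N)
      where
      lemma : ∀ x → (x + 1ℤ) · (x · x - x + 1ℤ) ≡ x · (x · (x · 1ℤ)) + 1ℤ
      lemma = solve-∀

    odd[3^] : ∀ k → Odd (3 ℕ.^ k)
    odd[3^] k = odd-^ k (toWitnessFalse {a? = 2 ℕ.∣? 3} _)

    ∤later-N : ∀ p j k → ¬ proj₁ p ℕ.∣ 3 → p ∣ᵖ N j → ¬ p ∣ᵖ N (suc j ℕ.+ k)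
    ∤later-N p j k p∤3 p∣N p∣N′ = p∤3 (∣⇒∣ᵤ {+ proj₁ p} {+ 3} (∣-resp-≡ℤ p
      (≡ℤ-+ p (≡ℤ-+ p (≡ℤ-* p b≡-1 b≡-1) (≡ℤ-neg p b≡-1)) (≡ℤ-reflexive p {1ℤ} refl)) p∣N′))
      where
      b≡-1 : b (suc j ℕ.+ k) ≡ℤ - 1ℤ [mod p ]
      b≡-1 = ∣+⇒≡- p _ 1ℤ (subst (λ n → p ∣ᵖ (+ a) ^ n + 1ℤ)
        (trans (ℕ.*-comm (3 ℕ.^ k) (3 ℕ.^ suc j)) (sym (ℕ.^-distribˡ-+-* 3 (suc j) k)))
        (power-+1 p (3 ℕ.^ k) (3 ℕ.^ suc j) (odd[3^] k) (∣N⇒∣b+1 p j p∣N)))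

    -- If the prime found at index j divides D, it is divided out and the search resumes at j + 1.
    -- Later primes differ from it by `∤later-N`, so avoiding the quotient is avoiding D; the
    -- recursion ends because D decreases.
    avoiding : ∀ D → .{{NonZero D}} → Acc ℕ._<_ D → ∀ j →
               ∃[ k ] ∃[ p ] (p ∣ᵖ N (j ℕ.+ k) × ¬ proj₁ p ℕ.∣ D)
    avoiding D (acc rec) j with divisor-of-N j
    ... | p , p∤3 , p∣N with proj₁ p ℕ.∣? D
    ...   | no  p∤D = 0 , p , subst (λ i → p ∣ᵖ N i) (sym (ℕ.+-identityʳ j)) p∣N , p∤D
    ...   | yes p∣D@(ℕ.divides q D≡qp)
      with avoiding q {{ℕ.quotient≢0 p∣D}}
             (rec (ℕ.quotient-< p∣D {{prime⇒nonTrivial (proj₂ p)}})) (suc j)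
    ...     | k , p′ , p′∣N , p′∤q =
      suc k , p′ , subst (λ i → p′ ∣ᵖ N i) (sym (ℕ.+-suc j k)) p′∣N , p′∤D
      where
      p′∤p : ¬ proj₁ p′ ℕ.∣ proj₁ p
      p′∤p p′∣p =
        [ (λ p′≡1 → prime∤1 p′ (subst (ℕ._∣ 1) (sym p′≡1) ℕ.∣-refl))
        , (λ p′≡p → ∤later-N p j k p∤3 p∣N (subst (λ r → + r ∣ N (suc j ℕ.+ k)) p′≡p p′∣N)) ]′
        (prime⇒irreducible (proj₂ p) p′∣p)
      p′∤D : ¬ proj₁ p′ ℕ.∣ D
      p′∤D p′∣D = [ p′∤q , p′∤p ]′
        (euclidsLemma q (proj₁ p) (proj₂ p′) (subst (proj₁ p′ ℕ.∣_) D≡qp p′∣D))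

  infinite-odd-power+1 : Infinite λ p → ∃[ m ] (Odd m × p ∣ᵖ (+ a) ^ m + 1ℤ)
  infinite-odd-power+1 D D≢0
    with avoiding ∣ D ∣ {{ℕ.≢-nonZero (D≢0 ∘ ℤ.∣i∣≡0⇒i≡0)}} (<-wellFounded ∣ D ∣) 0
  ... | j , p , p∣N , p∤D =
    p , (3 ℕ.^ suc j , odd[3^] (suc j) , ∣N⇒∣b+1 p j p∣N) , p∤D ∘ ∣⇒∣ᵤ

-- Reduction of ℚ[x] and of the residual square root modulo p

product-of-primes : List ℙ → ℤ
product-of-primes []       = 1ℤ
product-of-primes (p ∷ ps) = + proj₁ p · product-of-primes ps

product-of-primes≢0 : ∀ ps → product-of-primes ps ≢ 0ℤ
product-of-primes≢0 []       ()
product-of-primes≢0 ((p , p-prime) ∷ ps) =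
  *-≢0 (ℕ.≢-nonZero⁻¹ p {{prime⇒nonZero p-prime}} ∘ ℤ.+-injective) (product-of-primes≢0 ps)

∈⇒∣product-of-primes : ∀ {p ps} → p ∈ ps → p ∣ᵖ product-of-primes ps
∈⇒∣product-of-primes {p} {_ ∷ ps} (here refl) = ∣m⇒∣m*n (product-of-primes ps) ∣-refl
∈⇒∣product-of-primes {p} {q ∷ _}  (there p∈)  = ∣n⇒∣m*n (+ proj₁ q) (∈⇒∣product-of-primes p∈)

outside : ∀ {Q} → FinitelyMany Q → ∃[ D ] (D ≢ 0ℤ × (∀ p → ¬ p ∣ᵖ D → ¬ Q p))
outside (ps , Q⇒∈) = product-of-primes ps , product-of-primes≢0 ps ,
  λ p p∤ q → p∤ (∈⇒∣product-of-primes (Q⇒∈ p q))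

*-∈ℤ₍₎ : ∀ {q r p} → q ∈ℤ₍ p ₎ → r ∈ℤ₍ p ₎ → q ℚ.* r ∈ℤ₍ p ₎
*-∈ℤ₍₎ {q@record{}} {r@record{}} {p} q∈ r∈ = fraction (↥ q · ↥ r) (↧ₙ q ℕ.* ↧ₙ r)
  ([ ∈ℤ₍₎⇒p∤↧ {q} {p} q∈ , ∈ℤ₍₎⇒p∤↧ {r} {p} r∈ ]′ ∘ euclidsLemma (↧ₙ q) (↧ₙ r) (proj₂ p)) refl

integer∈ℤ₍₎ : ∀ p z → z / 1 ∈ℤ₍ p ₎
integer∈ℤ₍₎ p z = fraction z 1 (prime∤1 p) refl

integer-mod : ∀ p z → (z / 1) mod p ≡ℤ z [mod p ]
integer-mod p z = ≡ℤ-trans p (≡ℤ-reflexive p (sym (ℤ.*-identityʳ ((z / 1) mod p))))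
  (mod-unique {z / 1} {p} z 1 (prime∤1 p) refl)

-- Write x = y + p r with y and r both p-integral; reduction is then additive, and p r reduces to 0.
mod-cong : ∀ p x y → x ≡ℚ y [mod p ] → x mod p ≡ℤ y mod p [mod p ]
mod-cong p x y ((r , r∈ , x-y≡Pr) , y∈) = ≡ℤ-trans p
  (≡ℤ-reflexive p (cong (_mod p) x≡y+Pr))
  (≡ℤ-trans p (+-mod {y} {P ℚ.* r} {p} y∈ (*-∈ℤ₍₎ {P} {r} {p} P∈ r∈))
    (≡ℤ-trans p (≡ℤ-+ p (≡ℤ-reflexive p {y mod p} refl) Pr≡0)
      (≡ℤ-reflexive p (ℤ.+-identityʳ (y mod p)))))
  where
  P = + proj₁ p / 1
  P∈ = integer∈ℤ₍₎ p (+ proj₁ p)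
  P≡0 : + proj₁ p ≡ℤ 0ℤ [mod p ]
  P≡0 = congruent (subst (p ∣ᵖ_) (sym (ℤ.+-identityʳ (+ proj₁ p))) ∣-refl)
  Pr≡0 : (P ℚ.* r) mod p ≡ℤ 0ℤ [mod p ]
  Pr≡0 = ≡ℤ-trans p (*-mod {P} {r} {p} P∈ r∈)
    (≡ℤ-trans p (≡ℤ-* p
        (≡ℤ-trans p (integer-mod p (+ proj₁ p)) P≡0) (≡ℤ-reflexive p {r mod p} refl))
      (≡ℤ-reflexive p (ℤ.*-zeroˡ (r mod p))))
  x≡y+Pr : x ≡ y ℚ.+ P ℚ.* r
  x≡y+Pr = begin
    x                    ≡⟨ ℚ.+-identityʳ x ⟨
    x ℚ.+ 0ℚ             ≡⟨ cong (x ℚ.+_) (ℚ.+-inverseˡ y) ⟨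
    x ℚ.+ (ℚ.- y ℚ.+ y)  ≡⟨ ℚ.+-assoc x (ℚ.- y) y ⟨
    (x ℚ.- y) ℚ.+ y      ≡⟨ cong (ℚ._+ y) x-y≡Pr ⟩
    P ℚ.* r ℚ.+ y        ≡⟨ ℚ.+-comm (P ℚ.* r) y ⟩
    y ℚ.+ P ℚ.* r        ∎
    where open ≡-Reasoning

mod-reduced : ∀ p q → ¬ proj₁ p ℕ.∣ ↧ₙ q → (q mod p) · ↧ q ≡ℤ ↥ q [mod p ]
mod-reduced p q p∤↧ = mod-unique {q} {p} (↥ q) (↧ₙ q) p∤↧ (sym (ℚ.↥p/↧p≡p q))

⟦map*⟧ : ∀ s {d} (g : Vec ℤ d) x → ⟦ map (s ·_) g ⟧ x ≡ s · ⟦ g ⟧ x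
⟦map*⟧ s []      x = sym (ℤ.*-zeroʳ s)
⟦map*⟧ s (c ∷ g) x = trans (cong (λ y → s · c + x · y) (⟦map*⟧ s g x)) (lemma s c x (⟦ g ⟧ x))
  where
  lemma : ∀ s c x y → s · c + x · (s · y) ≡ s · (c + x · y)
  lemma = solve-∀

↧≢0 : ∀ q → ↧ q ≢ 0ℤ
↧≢0 q@record{} ()

-- `D` is the product of the denominators of the coefficients. Primes dividing it are excluded,
-- since there `_mod_` takes its default value 0. `G` is independent of p and α.
clear-denominators : ∀ g → ∃[ D ] (D ≢ 0ℤ × ∃[ G ] ∀ p → ¬ p ∣ᵖ D → ∀ α →
  D · eval g α p ≡ℤ ⟦_⟧ {length g} G (α p) [mod p ])
clear-denominators []      = 1ℤ , (λ ()) , [] , λ p _ α → ≡ℤ-reflexive p refl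
clear-denominators (c ∷ g) with clear-denominators g
... | D , D≢0 , G , G≡ = ↧ c · D , *-≢0 (↧≢0 c) D≢0 , ↥ c · D ∷ map (↧ c ·_) G , λ p p∤ α →
  ≡ℤ-trans p
    (≡ℤ-reflexive p (lemma₁ (↧ c) D (c mod p) (α p) (eval g α p)))
    (≡ℤ-trans p
      (≡ℤ-+ p
        (≡ℤ-* p (mod-reduced p c (p∤ ∘ ∣m⇒∣m*n D ∘ ∣ᵤ⇒∣ {+ proj₁ p} {↧ c}))
                (≡ℤ-reflexive p {D} refl))
        (≡ℤ-* p (≡ℤ-reflexive p {↧ c · α p} refl) (G≡ p (p∤ ∘ ∣n⇒∣m*n (↧ c)) α)))
      (≡ℤ-reflexive p (trans (lemma₂ (↧ c) (α p) (↥ c · D) (⟦ G ⟧ (α p)))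
        (cong (λ y → ↥ c · D + α p · y) (sym (⟦map*⟧ (↧ c) G (α p)))))))
  where
  lemma₁ : ∀ b D m a v → b · D · (m + a · v) ≡ m · b · D + b · a · (D · v)
  lemma₁ = solve-∀
  lemma₂ : ∀ b a u v → u + b · a · v ≡ u + a · (b · v)
  lemma₂ = solve-∀

↥≢0 : ∀ q → q ≢ 0ℚ → ↥ q ≢ 0ℤ
↥≢0 q q≢0 ↥q≡0 = q≢0 (ℚ.↥p≡0⇒p≡0 q ↥q≡0)

-- bad collects the primes dividing a denominator; the factors X of g have been divided out.
record IntegralMultiple (g : ℚ[x]) : Set where
  field
    {degree}     : ℕ
    constant     : ℤ
    coefficients : Vec ℤ degree
    constant≢0   : constant ≢ 0ℤ
    bad          : ℤ
    bad≢0        : bad ≢ 0ℤ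
    root         : ∀ p → ¬ p ∣ᵖ bad → ∀ α → ¬ p ∣ᵖ α p →
                   p ∣ᵖ eval g α p → p ∣ᵖ ⟦ constant ∷ coefficients ⟧ (α p)

-- When the constant term is zero, g = X h, and Euclid's lemma discards X because p does not divide
-- α p. The recursion stops at the lowest nonzero coefficient, whose numerator times the cleared
-- denominators of the rest is `constant`.
integral-multiple : ∀ g → NonZeroPoly g → IntegralMultiple g
integral-multiple (c ∷ g) c∷g≢0 with c ℚ.≟ 0ℚ | c∷g≢0
... | no c≢0  | _ = record
  { constant     = ↥ c · proj₁ cleared
  ; coefficients = map (↧ c ·_) (proj₁ (proj₂ (proj₂ cleared)))
  ; constant≢0   = *-≢0 (↥≢0 c c≢0) (proj₁ (proj₂ cleared))
  ; bad          = proj₁ (clear-denominators (c ∷ g))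
  ; bad≢0        = proj₁ (proj₂ (clear-denominators (c ∷ g)))
  ; root         = λ p p∤ α _ p∣ → ∣-resp-≡ℤ p
      (proj₂ (proj₂ (proj₂ (clear-denominators (c ∷ g)))) p p∤ α)
      (∣n⇒∣m*n (proj₁ (clear-denominators (c ∷ g))) p∣)
  }
  where cleared = clear-denominators g
... | yes c≡0 | here c≢0   = ⊥-elim (c≢0 c≡0)
... | yes refl | there g≢0 = record
  { constant     = constant
  ; coefficients = coefficients
  ; constant≢0   = constant≢0
  ; bad          = bad
  ; bad≢0        = bad≢0
  ; root         = λ p p∤ α p∤α p∣ → root p p∤ α p∤α
      ([ ⊥-elim ∘ p∤α , (λ d → d) ]′ (euclid p (α p) (∣-resp-≡ℤ p
        (≡ℤ-trans p (≡ℤ-+ p (integer-mod p 0ℤ) (≡ℤ-reflexive p {α p · eval g α p} refl))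
          (≡ℤ-reflexive p (ℤ.+-identityˡ (α p · eval g α p)))) p∣)))
  }
  where open IntegralMultiple (integral-multiple g g≢0)

-- For nonempty g of length d this is s ^ (d - 1) · g(x / s), whose roots are s times those of g.
-- The further factor s in `⟦scale⟧` keeps the exponent natural for the empty vector.
scale : ℤ → ∀ {d} → Vec ℤ d → Vec ℤ d
scale s []              = []
scale s {suc d} (c ∷ g) = c · s ^ d ∷ scale s g

⟦scale⟧ : ∀ s {d} (g : Vec ℤ d) x → ⟦ scale s g ⟧ (s · x) · s ≡ s ^ d · ⟦ g ⟧ x
⟦scale⟧ s []              x = trans (ℤ.*-zeroˡ s) (sym (ℤ.*-zeroʳ 1ℤ))
⟦scale⟧ s {suc d} (c ∷ g) x = begin
  (c · s ^ d + s · x · ⟦ scale s g ⟧ (s · x)) · s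
    ≡⟨ lemma₁ c s (s ^ d) x (⟦ scale s g ⟧ (s · x)) ⟩
  s · (c · s ^ d + x · (⟦ scale s g ⟧ (s · x) · s))
    ≡⟨ cong (λ y → s · (c · s ^ d + x · y)) (⟦scale⟧ s g x) ⟩
  s · (c · s ^ d + x · (s ^ d · ⟦ g ⟧ x))
    ≡⟨ lemma₂ c s (s ^ d) x (⟦ g ⟧ x) ⟩
  s ^ suc d · (c + x · ⟦ g ⟧ x) ∎
  where
  open ≡-Reasoning
  lemma₁ : ∀ c s t x y → (c · t + s · x · y) · s ≡ s · (c · t + x · (y · s))
  lemma₁ = solve-∀
  lemma₂ : ∀ c s t x y → s · (c · t + x · (t · y)) ≡ s · t · (c + x · y)
  lemma₂ = solve-∀

^-distribʳ-* : ∀ x y k → (x · y) ^ k ≡ x ^ k · y ^ k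
^-distribʳ-* x y zero    = refl
^-distribʳ-* x y (suc k) = trans (cong (x · y ·_) (^-distribʳ-* x y k)) (lemma x y (x ^ k) (y ^ k))
  where
  lemma : ∀ x y u v → x · y · (u · v) ≡ x · u · (y · v)
  lemma = solve-∀

+∣x∣²≡x² : ∀ x → + (∣ x ∣ ℕ.* ∣ x ∣) ≡ x · x
+∣x∣²≡x² (+ x)        = ℤ.pos-* x x
+∣x∣²≡x² (ℤ.-[1+ x ]) = refl

+∣x∣^2k≡x^2k : ∀ x k → + (∣ x ∣ ℕ.^ (2 ℕ.* k)) ≡ x ^ (2 ℕ.* k)
+∣x∣^2k≡x^2k x k = begin
  + (∣ x ∣ ℕ.^ (2 ℕ.* k))         ≡⟨ cong +_ (square-^ℕ ∣ x ∣ k) ⟨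
  + ((∣ x ∣ ℕ.* ∣ x ∣) ℕ.^ k)     ≡⟨ pos-^ (∣ x ∣ ℕ.* ∣ x ∣) k ⟩
  (+ (∣ x ∣ ℕ.* ∣ x ∣)) ^ k       ≡⟨ cong (_^ k) (+∣x∣²≡x² x) ⟩
  (x · x) ^ k                     ≡⟨ square-^ x k ⟩
  x ^ (2 ℕ.* k)                   ∎
  where open ≡-Reasoning

odd⇒2∣+1 : ∀ u → Odd u → 2 ℕ.∣ u ℕ.+ 1
odd⇒2∣+1 zero          odd-u = ⊥-elim (odd-u (2 ℕ.∣0))
odd⇒2∣+1 (suc zero)    _     = ℕ.∣-refl
odd⇒2∣+1 (suc (suc u)) odd-u =
  ℕ.∣m∣n⇒∣m+n {2} {2} ℕ.∣-refl (odd⇒2∣+1 u (odd-u ∘ ℕ.∣m∣n⇒∣m+n ℕ.∣-refl))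

half-power-squared : ∀ n u → Odd u →
  n ^ ((u ℕ.+ 1) ℕ./ 2) · n ^ ((u ℕ.+ 1) ℕ./ 2) ≡ n · n ^ u
half-power-squared n u odd-u = begin
  n ^ h · n ^ h      ≡⟨ cong (n ^ h ·_) (ℤ.*-identityʳ (n ^ h)) ⟨
  (n ^ h) ^ 2        ≡⟨ ℤ.^-*-assoc n h 2 ⟩
  n ^ (h ℕ.* 2)      ≡⟨ cong (n ^_) (ℕ.m/n*n≡m (odd⇒2∣+1 u odd-u)) ⟩
  n ^ (u ℕ.+ 1)      ≡⟨ cong (n ^_) (ℕ.+-comm u 1) ⟩
  n · n ^ u          ∎
  where
  open ≡-Reasoning
  h = (u ℕ.+ 1) ℕ./ 2

infinite-avoiding : ∀ {S D} → D ≢ 0ℤ → Infinite S → Infinite λ p → S p × ¬ p ∣ᵖ D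
infinite-avoiding {D = D} D≢0 S-infinite E E≢0 with S-infinite (D · E) (*-≢0 D≢0 E≢0)
... | p , p∈S , p∤ = p , (p∈S , p∤ ∘ ∣m⇒∣m*n E) , p∤ ∘ ∣n⇒∣m*n D

-- The powers `n ^ u₂ (p - 1)` and the values of f at suitable primes

module _ (n : ℤ) where

  private
    -- The exponent is even, so that `a k` is also a power of n itself, and at least 2, so that
    -- `a k` reaches the bound 4 required for `infinite-odd-power+1`.
    a : ℕ → ℕ
    a k = ∣ n ∣ ℕ.^ (2 ℕ.* 2 ℕ.^ k)

    4≤a : 1 < ∣ n ∣ → ∀ k → 4 ℕ.≤ a k
    4≤a 1<∣n∣ k = ℕ.≤-trans (ℕ.^-monoʳ-≤ 2 {2} {2 ℕ.* 2 ℕ.^ k} (ℕ.*-monoʳ-≤ 2 (ℕ.m^n>0 2 k)))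
      (ℕ.^-monoˡ-≤ (2 ℕ.* 2 ℕ.^ k) 1<∣n∣)

  PrimeOfLevel : ℕ → ℙ → Set
  PrimeOfLevel k p = ∃[ m ] (Odd m × p ∣ᵖ (+ a k) ^ m + 1ℤ)

  infinite-level : 1 < ∣ n ∣ → ∀ k → Infinite (PrimeOfLevel k)
  infinite-level 1<∣n∣ k = infinite-odd-power+1 (a k) (4≤a 1<∣n∣ k)

  level-power : ∀ k p → PrimeOfLevel k p →
                (n ^ u₂ (proj₁ p ℕ.∸ 1)) ^ (2 ℕ.* 2 ℕ.^ k) ≡ℤ - 1ℤ [mod p ]
  level-power k p (m , odd-m , p∣) = subst (_≡ℤ - 1ℤ [mod p ]) (eq (u₂ (proj₁ p ℕ.∸ 1)))
    (∣+⇒≡- p ((+ a k) ^ u₂ (proj₁ p ℕ.∸ 1)) 1ℤ (power-u₂ p (a k) m odd-m p∣))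
    where
    open ≡-Reasoning
    K = 2 ℕ.* 2 ℕ.^ k
    eq : ∀ u → (+ a k) ^ u ≡ (n ^ u) ^ K
    eq u = begin
      (+ a k) ^ u    ≡⟨ cong (_^ u) (+∣x∣^2k≡x^2k n (2 ℕ.^ k)) ⟩
      (n ^ K) ^ u    ≡⟨ ℤ.^-*-assoc n K u ⟩
      n ^ (K ℕ.* u)  ≡⟨ cong (n ^_) (ℕ.*-comm K u) ⟩
      n ^ (u ℕ.* K)  ≡⟨ ℤ.^-*-assoc n u K ⟨
      (n ^ u) ^ K    ∎

-- If z² w = y with w ^ 2ᵏ⁺¹ = -1, then (z⁴) ^ 2ᵏ = -(y²) ^ 2ᵏ.
fourth-power : ∀ p {z w y} k → z · z · w ≡ℤ y [mod p ] → w ^ (2 ℕ.* 2 ℕ.^ k) ≡ℤ - 1ℤ [mod p ] →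
               p ∣ᵖ (z · z · (z · z)) ^ (2 ℕ.^ k) + + ((∣ y ∣ ℕ.* ∣ y ∣) ℕ.^ (2 ℕ.^ k))
fourth-power p {z} {w} {y} k z²w≡y wᴷ≡-1 = ≡-⇒∣+ p _ _ (≡ℤ-trans p
  (≡ℤ-reflexive p (trans (square-^ (z · z) (2 ℕ.^ k)) (lemma ((z · z) ^ K))))
  (≡ℤ-neg p (≡ℤ-trans p
    (≡ℤ-* p (≡ℤ-reflexive p {(z · z) ^ K} refl) (≡ℤ-sym p wᴷ≡-1))
    (≡ℤ-trans p (≡ℤ-reflexive p (sym (^-distribʳ-* (z · z) w K)))
      (≡ℤ-trans p (≡ℤ-^ p K z²w≡y) (≡ℤ-reflexive p yᴷ))))))
  where
  K = 2 ℕ.* 2 ℕ.^ k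
  lemma : ∀ x → x ≡ - (x · - 1ℤ)
  lemma = solve-∀
  yᴷ : y ^ K ≡ + ((∣ y ∣ ℕ.* ∣ y ∣) ℕ.^ (2 ℕ.^ k))
  yᴷ = trans (sym (+∣x∣^2k≡x^2k y (2 ℕ.^ k))) (cong +_ (sym (square-^ℕ ∣ y ∣ (2 ℕ.^ k))))

-- (scaling · f)² w ≡ target for w = n ^ u₂ (p - 1): true for residues, false for nonresidues.
scaling : ℤ → ℚ → ℤ
scaling n q = n · ↧ q

target : ℤ → ℚ → Bool → ℤ
target n q true  = scaling n q · scaling n q
target n q false = n · (↥ q · ↥ q)

module _ (n : ℤ) (q : ℚ) (f : ℙ → ℚ) where

  private
    φ = image f
    b = ↧ q
    s = scaling n q

  module _ (p : ℙ) (f∈ : f p ∈ℤ₍ p ₎) where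

    private
      u = u₂ (proj₁ p ℕ.∸ 1)
      w = n ^ u

      r-mod : (TS n p / 1 * f p) mod p ≡ℤ TS n p · φ p [mod p ]
      r-mod = ≡ℤ-trans p (*-mod {TS n p / 1} {f p} {p} (integer∈ℤ₍₎ p (TS n p)) f∈)
        (≡ℤ-* p (integer-mod p (TS n p)) (≡ℤ-reflexive p {φ p} refl))

      r∈ : TS n p / 1 * f p ∈ℤ₍ p ₎
      r∈ = *-∈ℤ₍₎ {TS n p / 1} {f p} {p} (integer∈ℤ₍₎ p (TS n p)) f∈

      TS² : TS n p · TS n p ≡ n · w
      TS² = half-power-squared n u (u₂-odd (proj₁ p ℕ.∸ 1) {{predecessor-nonZero p}})

    -- With T = `TS n p`, T² = n w gives (s φ)² w = n b² (T φ)², and (T φ)² ≡ n. The factor n in s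
    -- replaces a division by n.
    residue-case : ((TS n p / 1 * f p) * (TS n p / 1 * f p)) ≡ℚ n / 1 [mod p ] →
                   s · φ p · (s · φ p) · w ≡ℤ target n q true [mod p ]
    residue-case r²≡n = ≡ℤ-trans p (≡ℤ-reflexive p (begin
        s · φ p · (s · φ p) · w
          ≡⟨ lemma₁ n b (φ p) w ⟩
        n · b · b · (n · w · (φ p · φ p))
          ≡⟨ cong (λ x → n · b · b · (x · (φ p · φ p))) TS² ⟨
        n · b · b · (TS n p · TS n p · (φ p · φ p))
          ≡⟨ lemma₂ (n · b · b) (TS n p) (φ p) ⟩
        n · b · b · (TS n p · φ p · (TS n p · φ p))  ∎))
      (≡ℤ-trans p (≡ℤ-* p (≡ℤ-reflexive p {n · b · b} refl)
        (≡ℤ-trans p (≡ℤ-sym p (≡ℤ-trans p (*-mod {_} {_} {p} r∈ r∈) (≡ℤ-* p r-mod r-mod)))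
          (≡ℤ-trans p (mod-cong p _ _ r²≡n) (integer-mod p n))))
        (≡ℤ-reflexive p (lemma₃ n b)))
      where
      open ≡-Reasoning
      lemma₁ : ∀ n b f w → n · b · f · (n · b · f) · w ≡ n · b · b · (n · w · (f · f))
      lemma₁ = solve-∀
      lemma₂ : ∀ c t f → c · (t · t · (f · f)) ≡ c · (t · f · (t · f))
      lemma₂ = solve-∀
      lemma₃ : ∀ n b → n · b · b · n ≡ n · b · (n · b)
      lemma₃ = solve-∀

    -- Here (s φ)² w = n (T φ b)² with T = `TS n p`, and T φ ≡ q turns T φ b into the numerator of
    -- q.
    nonresidue-case : ¬ p ∣ᵖ b → (TS n p / 1 * f p) ≡ℚ q [mod p ] →
                      s · φ p · (s · φ p) · w ≡ℤ target n q false [mod p ]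
    nonresidue-case p∤b r≡q = ≡ℤ-trans p (≡ℤ-reflexive p (begin
        s · φ p · (s · φ p) · w
          ≡⟨ lemma₁ n b (φ p) w ⟩
        n · (b · b · (φ p · φ p) · (n · w))
          ≡⟨ cong (λ x → n · (b · b · (φ p · φ p) · x)) TS² ⟨
        n · (b · b · (φ p · φ p) · (TS n p · TS n p))
          ≡⟨ lemma₂ n b (φ p) (TS n p) ⟩
        n · (TS n p · φ p · b · (TS n p · φ p · b))  ∎))
      (≡ℤ-* p (≡ℤ-reflexive p {n} refl) (≡ℤ-* p Tφb≡a Tφb≡a))
      where
      open ≡-Reasoning
      Tφb≡a : TS n p · φ p · b ≡ℤ ↥ q [mod p ]
      Tφb≡a = ≡ℤ-trans p
        (≡ℤ-* p (≡ℤ-trans p (≡ℤ-sym p r-mod) (mod-cong p _ q r≡q)) (≡ℤ-reflexive p {b} refl))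
        (mod-reduced p q (p∤b ∘ ∣ᵤ⇒∣ {+ proj₁ p} {b}))
      lemma₁ : ∀ n b f w → n · b · f · (n · b · f) · w ≡ n · (b · b · (f · f) · (n · w))
      lemma₁ = solve-∀
      lemma₂ : ∀ n b f t → n · (b · b · (f · f) · (t · t)) ≡ n · (t · f · b · (t · f · b))
      lemma₂ = solve-∀

corollary5p6 : (f : ℙ → ℚ) → f ∈𝒜̃ →
    (∃ λ (n : ℤ) → (1 < ∣ n ∣ × IsResidualSquareRoot n (λ p → (TS n p / 1) * f p))) →
    NaivelyTranscendental (image f)
corollary5p6 f f∈𝒜̃ (n , 1<∣n∣ , _ , q , q≢0 , square-root) (g , g≢0 , g[f]≈0) =
  -- Each transform squares the constant coefficient, so `H` starts, by computation, with the fourth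
  -- power of that of `G`.
  no-common-root (tail H) x (λ i → ∣ Y i ∣ ℕ.* ∣ Y i ∣) S
    (*-≢0 (*-≢0 G₀≢0 G₀≢0) (*-≢0 G₀≢0 G₀≢0))
    (λ i → [ Y≢0 i ∘ ℤ.∣i∣≡0⇒i≡0 , Y≢0 i ∘ ℤ.∣i∣≡0⇒i≡0 ]′ ∘ ℕ.m*n≡0⇒m≡0∨n≡0 ∣ Y i ∣)
    S-infinite
    powers
    -- `S k` already omits all exceptional primes, so 1 serves as the exceptional integer.
    (λ k → 1ℤ , (λ ()) , λ p p∈S _ → root k p p∈S)
  where
  open IntegralMultiple (integral-multiple g g≢0) renaming (root to root′)
  φ = image f
  σ = scaling n q
  Y = target n q
  f-bad = outside f∈𝒜̃
  g-bad = outside g[f]≈0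

  n≢0 : n ≢ 0ℤ
  n≢0 refl = ℕ.n≮0 1<∣n∣
  σ≢0 : σ ≢ 0ℤ
  σ≢0 = *-≢0 n≢0 (↧≢0 q)
  Y≢0 : ∀ i → Y i ≢ 0ℤ
  Y≢0 true  = *-≢0 σ≢0 σ≢0
  Y≢0 false = *-≢0 n≢0 (*-≢0 (↥≢0 q q≢0) (↥≢0 q q≢0))

  -- `D₁` covers the primes where f is not integral, g(f) does not vanish or a coefficient of g has
  -- a denominator; `D₂` covers those dividing the scaling factor or a target.
  D D₁ D₂ : ℤ
  D₁ = proj₁ f-bad · proj₁ g-bad · bad
  D₂ = σ · (Y true · Y false)
  D  = D₁ · D₂
  D≢0 : D ≢ 0ℤ
  D≢0 = *-≢0 (*-≢0 (*-≢0 (proj₁ (proj₂ f-bad)) (proj₁ (proj₂ g-bad))) bad≢0)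
             (*-≢0 σ≢0 (*-≢0 (Y≢0 true) (Y≢0 false)))

  S : ℕ → ℙ → Set
  S k p = PrimeOfLevel n k p × ¬ p ∣ᵖ D

  S-infinite : ∀ k → Infinite (S k)
  S-infinite k = infinite-avoiding D≢0 (infinite-level n 1<∣n∣ k)

  x : ℙ → ℤ
  x p = σ · φ p · (σ · φ p) · (σ · φ p · (σ · φ p))

  w : ℙ → ℤ
  w p = n ^ u₂ (proj₁ p ℕ.∸ 1)

  p∤Y : ∀ p → ¬ p ∣ᵖ D → ∀ i → ¬ p ∣ᵖ Y i
  p∤Y p p∤D true  = p∤D ∘ ∣n⇒∣m*n D₁ ∘ ∣n⇒∣m*n σ ∘ ∣m⇒∣m*n (Y false)
  p∤Y p p∤D false = p∤D ∘ ∣n⇒∣m*n D₁ ∘ ∣n⇒∣m*n σ ∘ ∣n⇒∣m*n (Y true)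

  p∤σ : ∀ p → ¬ p ∣ᵖ D → ¬ p ∣ᵖ σ
  p∤σ p p∤D = p∤D ∘ ∣n⇒∣m*n D₁ ∘ ∣m⇒∣m*n (Y true · Y false)

  f∈ℤ₍₎ : ∀ p → ¬ p ∣ᵖ D → f p ∈ℤ₍ p ₎
  f∈ℤ₍₎ p p∤D = decidable-stable (f p ∈ℤ₍ p ₎?) (proj₂ (proj₂ f-bad) p
    (p∤D ∘ ∣m⇒∣m*n D₂ ∘ ∣m⇒∣m*n bad ∘ ∣m⇒∣m*n (proj₁ g-bad)))

  -- Rather than deciding whether n is a residue, the two congruences are decided. If both failed,
  -- `nonresidue-case` would show that n is not a nonresidue, and `residue-case` would then
  -- contradict the first failure.
  square : ∀ p → ¬ p ∣ᵖ D → ∃[ i ] (σ · φ p · (σ · φ p) · w p ≡ℤ Y i [mod p ])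
  square p p∤D with _≡ℤ?_ p (σ · φ p · (σ · φ p) · w p) (Y true)
                  | _≡ℤ?_ p (σ · φ p · (σ · φ p) · w p) (Y false)
  ... | yes ≡Y | _      = true , ≡Y
  ... | no _   | yes ≡Y = false , ≡Y
  ... | no ≢₁  | no ≢₂  = ⊥-elim (≢₁ (residue-case n q f p (f∈ℤ₍₎ p p∤D)
    (proj₂ (square-root p) λ nonresidue → ≢₂ (nonresidue-case n q f p (f∈ℤ₍₎ p p∤D)
      (p∤σ p p∤D ∘ ∣n⇒∣m*n n) (proj₁ (square-root p) nonresidue)))))

  powers : ∀ k p → S k p → ∃[ i ] p ∣ᵖ x p ^ (2 ℕ.^ k) + + ((∣ Y i ∣ ℕ.* ∣ Y i ∣) ℕ.^ (2 ℕ.^ k))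
  powers k p (level , p∤D) with square p p∤D
  ... | i , z²w≡Y = i , fourth-power p {σ · φ p} {w p} {Y i} k z²w≡Y (level-power n k p level)

  -- A prime dividing φ p would divide the target. This allows the factors X of g to be cancelled.
  p∤φ : ∀ p → ¬ p ∣ᵖ D → ¬ p ∣ᵖ φ p
  p∤φ p p∤D p∣φ with square p p∤D
  ... | i , z²w≡Y = p∤Y p p∤D i (∣-resp-≡ℤ p z²w≡Y
    (∣m⇒∣m*n (w p) (∣m⇒∣m*n (σ · φ p) (∣n⇒∣m*n σ p∣φ))))

  G₀≢0 : constant · σ ^ degree ≢ 0ℤ
  G₀≢0 = *-≢0 constant≢0 (^-≢0 degree σ≢0)

  G H : Vec ℤ (suc degree)
  G = scale σ (constant ∷ coefficients)
  H = graeffe (graeffe G)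

  -- Scaling moves the root φ p of g to z = σ φ p, and two Graeffe transforms move it on to z⁴ = x
  -- p.
  root : ∀ k p → S k p → p ∣ᵖ ⟦ H ⟧ (x p)
  root k p (_ , p∤D) = subst (p ∣ᵖ_) (sym (⟦graeffe⟧ (graeffe G) (z · z))) (∣m⇒∣m*n _
    (subst (p ∣ᵖ_) (sym (⟦graeffe⟧ G z)) (∣m⇒∣m*n _ p∣G[z])))
    where
    z = σ · φ p
    g[φ]≡0 : eval g φ p ≡ℤ 0ℤ [mod p ]
    g[φ]≡0 = decidable-stable (_≡ℤ?_ p (eval g φ p) 0ℤ) (proj₂ (proj₂ g-bad) p
      (p∤D ∘ ∣m⇒∣m*n D₂ ∘ ∣m⇒∣m*n bad ∘ ∣n⇒∣m*n (proj₁ f-bad)))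
    p∣G[z] : p ∣ᵖ ⟦ G ⟧ z
    p∣G[z] = [ (λ d → d) , ⊥-elim ∘ p∤σ p p∤D ]′ (euclid p (⟦ G ⟧ z)
      (subst (p ∣ᵖ_) (sym (⟦scale⟧ σ (constant ∷ coefficients) (φ p)))
        (∣n⇒∣m*n (σ ^ suc degree) (root′ p
          (p∤D ∘ ∣m⇒∣m*n D₂ ∘ ∣n⇒∣m*n (proj₁ f-bad · proj₁ g-bad)) φ (p∤φ p p∤D)
          (∣-resp-≡ℤ p (≡ℤ-sym p g[φ]≡0) (divides 0ℤ refl))))))
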